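{- Let $\alpha=\frac{2\pi}{3}$ and let $\alpha,\beta,\gamma$ be distinct. The spherical tilings by $12$ angle congruent pentagons with angles $\alpha,\alpha,\beta,\beta,\gamma$ are, up to symmetry, given by the following tilings (angle words on the dodecahedral pattern, as explained in the context). Tiling I: $P_1:\gamma\alpha\beta\beta\alpha$; $P_2:\alpha\gamma\alpha\beta\beta$; $P_3:\beta\beta\alpha\gamma\alpha$; $P_4:\alpha\beta\beta\alpha\gamma$; $P_5:\beta\alpha\gamma\alpha\beta$; $P_6:\gamma\alpha\beta\beta\alpha$; $P_7:\beta\alpha\gamma\alpha\beta$; $P_8:\alpha\beta\beta\alpha\gamma$; $P_9:\beta\beta\alpha\gamma\alpha$; $P_{10}:\alpha\gamma\alpha\beta\beta$; $P_{11}:\gamma\alpha\beta\beta\alpha$; $P_{12}:\beta\alpha\gamma\alpha\beta$. Tiling II: $P_1:\beta\alpha\beta\gamma\alpha$; $P_2:\alpha\beta\alpha\beta\gamma$; $P_3:\beta\gamma\alpha\beta\alpha$; $P_4:\alpha\beta\gamma\alpha\beta$; $P_5:\gamma\alpha\beta\alpha\beta$; $P_6:\beta\alpha\beta\gamma\alpha$; $P_7:\gamma\alpha\beta\alpha\beta$; $P_8:\alpha\beta\gamma\alpha\beta$; $P_9:\beta\gamma\alpha\beta\alpha$; $P_{10}:\alpha\beta\alpha\beta\gamma$; $P_{11}:\beta\alpha\beta\gamma\alpha$; $P_{12}:\gamma\alpha\beta\alpha\beta$; where, around any of the six edges $E_{1,5},E_{2,3},E_{4,8},E_{6,11},E_{7,12},E_{9,10}$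 (independently), one can exchange the four angles $\beta$ and $\gamma$ around that edge and still get a tiling; the tilings so obtained are included.
   Context: A spherical tiling by $12$ pentagons (graph embedded in $S^2$ with all vertices of degree $\ge 3$, every tile a five-edged region enclosed by a simple closed curve; edges may be any nice curves) is combinatorially the dodecahedral pattern: tiles $P_1,\dots,P_{12}$, where $P_i$ with list $(n_1,\dots,n_5)$ has edges in counterclockwise order $E_{i,n_1},\dots,E_{i,n_5}$, $E_{i,j}=E_{j,i}$ being the common edge of $P_i$ and $P_j$, and (with $n_6=n_1$) $E_{i,n_k},E_{i,n_{k+1}}$ meet at the vertex $V_{i,n_k,n_{k+1}}$ of degree $3$ shared by $P_i,P_{n_k},P_{n_{k+1}}$: $P_1:(2,3,4,5,6)$; $P_2:(1,6,11,7,3)$; $P_3:(1,2,7,8,4)$; $P_4:(1,3,8,9,5)$; $P_5:(1,4,9,10,6)$; $P_6:(1,5,10,11,2)$; $P_7:(12,8,3,2,11)$; $P_8:(12,9,4,3,7)$; $P_9:(12,10,5,4,8)$; $P_{10}:(12,11,6,5,9)$; $P_{11}:(12,7,2,6,10)$; $P_{12}:(7,11,10,9,8)$. "$P_i:w_1w_2w_3w_4w_5$" means that the angle of $P_i$ at $V_{i,n_k,n_{k+1}}$ is $w_k$ for $k=1,\dots,5$. An angle congruent tiling is considered as an assignment of angles to all (tile, vertex) corners such that the angles at every vertex sum to $2\pi$ and any two tiles are angle congruent, i.e. there is an adjacency-preserving correspondence of their edges that preserves the angles between adjacent edges (reflections allowed). No geometric realization by great arcs is required. The four angles around an edge $E_{i,j}$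 are the angles of $P_i$ and of $P_j$ at the two end vertices of $E_{i,j}$; exchanging $\beta$ and $\gamma$ around it means replacing $\beta$ by $\gamma$ and $\gamma$ by $\beta$ in these four corners. "Up to symmetry" means up to symmetries of the dodecahedral pattern (including reflections). -}

module Defs where

open import Data.Bool.Base using (Bool; true; false; _∧_; _∨_; if_then_else_)
import Data.Bool.Properties as Bool
open import Data.Fin.Base using (Fin; suc; toℕ)
open import Data.Fin.Patterns
open import Data.Fin.Permutation using (Permutation′; _⟨$⟩ʳ_)
open import Data.Fin.Properties using (_≟_)
open import Data.Fin.Subset using (Subset; ⁅_⁆; _∪_)
open import Data.Integer.Base as ℤ using (+_)
import Data.Integer.Properties as ℤ
open import Data.List.Base using (List; allFin; cartesianProduct; filter; foldr; map)
open import Data.Nat.Base as ℕ using (ℕ; zero; suc)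
open import Data.Nat.DivMod using (_mod_)
import Data.Nat.Properties as ℕ
open import Data.Product.Base using (Σ-syntax; ∃-syntax; _×_; _,_; proj₁; proj₂)
open import Data.Rational.Base as ℚ using (ℚ; 0ℚ; 1ℚ; ½; ∣_∣; mkℚ; *<*)
import Data.Rational.Properties as ℚ
open import Data.Rational.Solver using (module +-*-Solver)
import Data.Rational.Unnormalised.Base as ℚᵘ
import Data.Rational.Unnormalised.Properties as ℚᵘ
open import Data.Sum.Base using (_⊎_; inj₁; inj₂)
open import Data.Vec.Base using (Vec; []; _∷_; lookup; zip; foldr′; tabulate)
open import Data.Vec.Properties using (≡-dec)
open import Function.Bundles using (_⇔_)
open import Relation.Binary.Definitions using (DecidableEquality)
open import Relation.Binary.PropositionalEquality
  using (_≡_; refl; sym; trans; cong; cong₂; subst; subst₂)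
open import Relation.Nullary.Decidable using (does)

------------------------------------------------------------------------
-- Real numbers, as Cauchy sequences of rationals with a modulus

record ℝ : Set where
  constructor mkℝ
  field
    seq    : ℕ → ℚ
    cauchy : ∀ ε → 0ℚ ℚ.< ε →
             ∃[ N ] (∀ m n → N ℕ.≤ m → N ℕ.≤ n → ∣ seq m ℚ.- seq n ∣ ℚ.< ε)

open ℝ public

infix 4 _≈_

-- A record rather than a synonym, so that x and y can be inferred.
record _≈_ (x y : ℝ) : Set where
  constructor mk≈
  field
    close : ∀ ε → 0ℚ ℚ.< ε →
            ∃[ N ] (∀ n → N ℕ.≤ n → ∣ seq x n ℚ.- seq y n ∣ ℚ.< ε)

open _≈_ public

private
  halve : ∀ ε → 0ℚ ℚ.< ε → 0ℚ ℚ.< ½ ℚ.* ε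
  halve ε 0<ε = subst (ℚ._< ½ ℚ.* ε) (ℚ.*-zeroʳ ½) (ℚ.*-monoʳ-<-pos ½ 0<ε)

  halves : ∀ ε → ½ ℚ.* ε ℚ.+ ½ ℚ.* ε ≡ ε
  halves ε = trans (sym (ℚ.*-distribʳ-+ ε ½ ½)) (ℚ.*-identityˡ ε)

  +-difference : ∀ a b c d →
                 (a ℚ.+ b) ℚ.- (c ℚ.+ d) ≡ (a ℚ.- c) ℚ.+ (b ℚ.- d)
  +-difference = solve 4 (λ a b c d →
    (a :+ b) :- (c :+ d) := (a :- c) :+ (b :- d)) refl
    where open +-*-Solver

  *-difference : ∀ q a b → q ℚ.* a ℚ.- q ℚ.* b ≡ q ℚ.* (a ℚ.- b)
  *-difference = solve 3 (λ q a b → q :* a :- q :* b := q :* (a :- b)) refl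
    where open +-*-Solver

0ℝ : ℝ
0ℝ = mkℝ (λ _ → 0ℚ) (λ _ 0<ε → 0 , λ _ _ _ _ → 0<ε)

infixl 6 _+_

_+_ : ℝ → ℝ → ℝ
seq (x + y) n = seq x n ℚ.+ seq y n
cauchy (x + y) ε 0<ε = M ℕ.⊔ N , bound
  where
  M = proj₁ (cauchy x (½ ℚ.* ε) (halve ε 0<ε))
  N = proj₁ (cauchy y (½ ℚ.* ε) (halve ε 0<ε))

  bound : ∀ m n → M ℕ.⊔ N ℕ.≤ m → M ℕ.⊔ N ℕ.≤ n →
          ∣ (seq x m ℚ.+ seq y m) ℚ.- (seq x n ℚ.+ seq y n) ∣ ℚ.< ε
  bound m n ≤m ≤n = begin-strict
    ∣ (seq x m ℚ.+ seq y m) ℚ.- (seq x n ℚ.+ seq y n) ∣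
      ≡⟨ cong ∣_∣ (+-difference (seq x m) (seq y m) (seq x n) (seq y n)) ⟩
    ∣ (seq x m ℚ.- seq x n) ℚ.+ (seq y m ℚ.- seq y n) ∣
      ≤⟨ ℚ.∣p+q∣≤∣p∣+∣q∣ (seq x m ℚ.- seq x n) (seq y m ℚ.- seq y n) ⟩
    ∣ seq x m ℚ.- seq x n ∣ ℚ.+ ∣ seq y m ℚ.- seq y n ∣
      <⟨ ℚ.+-mono-<
           (proj₂ (cauchy x (½ ℚ.* ε) (halve ε 0<ε)) m n
             (ℕ.m⊔n≤o⇒m≤o M N ≤m) (ℕ.m⊔n≤o⇒m≤o M N ≤n))
           (proj₂ (cauchy y (½ ℚ.* ε) (halve ε 0<ε)) m n
             (ℕ.m⊔n≤o⇒n≤o M N ≤m) (ℕ.m⊔n≤o⇒n≤o M N ≤n)) ⟩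
    ½ ℚ.* ε ℚ.+ ½ ℚ.* ε
      ≡⟨ halves ε ⟩
    ε ∎
    where open ℚ.≤-Reasoning

infixr 7 _·_

_·_ : ℚ → ℝ → ℝ
seq (q · x) n = q ℚ.* seq x n
cauchy (q · x) ε 0<ε = proj₁ small , bound
  where
  c = 1ℚ ℚ.+ ∣ q ∣

  instance
    c-positive : ℚ.Positive c
    c-positive = ℚ.pos+nonNeg⇒pos 1ℚ ∣ q ∣ {{ℚ.∣-∣-nonNeg q}}

    c-nonZero : ℚ.NonZero c
    c-nonZero = ℚ.pos⇒nonZero c

    1/c-positive : ℚ.Positive (ℚ.1/ c)
    1/c-positive = ℚ.1/pos⇒pos c

  δ = ℚ.1/ c ℚ.* ε

  0<δ : 0ℚ ℚ.< δ
  0<δ = subst (ℚ._< δ) (ℚ.*-zeroʳ (ℚ.1/ c)) (ℚ.*-monoʳ-<-pos (ℚ.1/ c) 0<ε)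

  small = cauchy x δ 0<δ

  ∣q∣≤c : ∣ q ∣ ℚ.≤ c
  ∣q∣≤c = subst (ℚ._≤ c) (ℚ.+-identityˡ ∣ q ∣)
    (ℚ.+-monoˡ-≤ ∣ q ∣ (ℚ.nonNegative⁻¹ 1ℚ))

  bound : ∀ m n → proj₁ small ℕ.≤ m → proj₁ small ℕ.≤ n →
          ∣ q ℚ.* seq x m ℚ.- q ℚ.* seq x n ∣ ℚ.< ε
  bound m n ≤m ≤n = begin-strict
    ∣ q ℚ.* seq x m ℚ.- q ℚ.* seq x n ∣
      ≡⟨ cong ∣_∣ (*-difference q (seq x m) (seq x n)) ⟩
    ∣ q ℚ.* (seq x m ℚ.- seq x n) ∣
      ≡⟨ ℚ.∣p*q∣≡∣p∣*∣q∣ q (seq x m ℚ.- seq x n) ⟩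
    ∣ q ∣ ℚ.* ∣ seq x m ℚ.- seq x n ∣
      ≤⟨ ℚ.*-monoʳ-≤-nonNeg ∣ seq x m ℚ.- seq x n ∣
           {{ℚ.∣-∣-nonNeg (seq x m ℚ.- seq x n)}} ∣q∣≤c ⟩
    c ℚ.* ∣ seq x m ℚ.- seq x n ∣
      <⟨ ℚ.*-monoʳ-<-pos c (proj₂ small m n ≤m ≤n) ⟩
    c ℚ.* (ℚ.1/ c ℚ.* ε)
      ≡⟨ sym (ℚ.*-assoc c (ℚ.1/ c) ε) ⟩
    (c ℚ.* ℚ.1/ c) ℚ.* ε
      ≡⟨ cong (ℚ._* ε) (ℚ.*-inverseʳ c) ⟩
    1ℚ ℚ.* ε
      ≡⟨ ℚ.*-identityˡ ε ⟩
    ε ∎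
    where open ℚ.≤-Reasoning

------------------------------------------------------------------------
-- π = 4/1 - 4/3 + 4/5 - 4/7 + ⋯

leibnizTerm : ℕ → ℚ
leibnizTerm k = + 4 ℚ./ suc (2 ℕ.* k)

sign : ℕ → ℚ
sign zero    = 1ℚ
sign (suc k) = ℚ.- sign k

leibniz : ℕ → ℚ
leibniz zero    = 0ℚ
leibniz (suc n) = leibniz n ℚ.+ sign n ℚ.* leibnizTerm n

private
  -- leibnizTerm m - leibnizTerm (m + 1) + ⋯, with j terms
  alternating : ℕ → ℕ → ℚ
  alternating m zero    = 0ℚ
  alternating m (suc j) = leibnizTerm m ℚ.- alternating (suc m) j

  /-mono-≤ : ∀ {p q} → p ℚᵘ.≤ q → ℚ.fromℚᵘ p ℚ.≤ ℚ.fromℚᵘ q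
  /-mono-≤ {p} {q} p≤q = ℚ.toℚᵘ-cancel-≤
    (ℚᵘ.≤-respˡ-≃ (ℚᵘ.≃-sym (ℚ.toℚᵘ-fromℚᵘ p))
      (ℚᵘ.≤-respʳ-≃ (ℚᵘ.≃-sym (ℚ.toℚᵘ-fromℚᵘ q)) p≤q))

  /-mono-< : ∀ {p q} → p ℚᵘ.< q → ℚ.fromℚᵘ p ℚ.< ℚ.fromℚᵘ q
  /-mono-< {p} {q} p<q = ℚ.toℚᵘ-cancel-<
    (ℚᵘ.<-respˡ-≃ (ℚᵘ.≃-sym (ℚ.toℚᵘ-fromℚᵘ p))
      (ℚᵘ.<-respʳ-≃ (ℚᵘ.≃-sym (ℚ.toℚᵘ-fromℚᵘ q)) p<q))

  leibnizTerm-antitone : ∀ {m n} → m ℕ.≤ n → leibnizTerm n ℚ.≤ leibnizTerm m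
  leibnizTerm-antitone {m} {n} m≤n =
    /-mono-≤ {ℚᵘ.mkℚᵘ (+ 4) (2 ℕ.* n)} {ℚᵘ.mkℚᵘ (+ 4) (2 ℕ.* m)}
      (ℚᵘ.*≤* (ℤ.*-monoˡ-≤-nonNeg (+ 4)
        (ℤ.+≤+ (ℕ.s≤s (ℕ.*-monoʳ-≤ 2 m≤n)))))

  0≤leibnizTerm : ∀ m → 0ℚ ℚ.≤ leibnizTerm m
  0≤leibnizTerm m = /-mono-≤ {ℚᵘ.0ℚᵘ} {ℚᵘ.mkℚᵘ (+ 4) (2 ℕ.* m)}
    (ℚᵘ.nonNegative⁻¹ (ℚᵘ.mkℚᵘ (+ 4) (2 ℕ.* m)))

  leibnizTerm-small : ∀ ε → 0ℚ ℚ.< ε →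
                      leibnizTerm (2 ℕ.* ℚ.denominatorℕ ε) ℚ.< ε
  leibnizTerm-small ε@(mkℚ ℤ.+0 d _) 0<ε with ℚ.positive 0<ε
  ... | ()
  leibnizTerm-small ε@(mkℚ ℤ.-[1+ _ ] d _) 0<ε with ℚ.positive 0<ε
  ... | ()
  leibnizTerm-small ε@(mkℚ ℤ.+[1+ n ] d _) 0<ε =
    subst (leibnizTerm (2 ℕ.* suc d) ℚ.<_) (ℚ.fromℚᵘ-toℚᵘ ε)
      (/-mono-< {ℚᵘ.mkℚᵘ (+ 4) (2 ℕ.* (2 ℕ.* suc d))} {ℚ.toℚᵘ ε}
        (ℚᵘ.*<* (subst₂ ℤ._<_ (ℤ.pos-* 4 (suc d))
          (ℤ.pos-* (suc n) (suc (2 ℕ.* (2 ℕ.* suc d))))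
          (ℤ.+<+ (ℕ.≤-trans
            (ℕ.s≤s (ℕ.≤-reflexive (ℕ.*-assoc 2 2 (suc d))))
            (ℕ.m≤m+n _ _))))))

  alternating-bounds : ∀ m j → 0ℚ ℚ.≤ alternating m j ×
                               alternating m j ℚ.≤ leibnizTerm m
  alternating-bounds m zero    = ℚ.≤-refl , 0≤leibnizTerm m
  alternating-bounds m (suc j) with alternating-bounds (suc m) j
  ... | 0≤s , s≤t =
    subst (ℚ._≤ leibnizTerm m ℚ.- s) (ℚ.+-inverseʳ s)
      (ℚ.+-monoˡ-≤ (ℚ.- s)
        (ℚ.≤-trans s≤t (leibnizTerm-antitone (ℕ.n≤1+n m)))) ,
    subst (leibnizTerm m ℚ.- s ℚ.≤_) (ℚ.+-identityʳ (leibnizTerm m))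
      (ℚ.+-monoʳ-≤ (leibnizTerm m) (ℚ.neg-antimono-≤ 0≤s))
    where s = alternating (suc m) j

  leibniz-difference : ∀ m j →
    leibniz (j ℕ.+ m) ℚ.- leibniz m ≡ sign m ℚ.* alternating m j
  leibniz-difference m zero =
    trans (ℚ.+-inverseʳ (leibniz m)) (sym (ℚ.*-zeroʳ (sign m)))
  leibniz-difference m (suc j) = trans
    (cong (λ k → leibniz k ℚ.- leibniz m) (sym (ℕ.+-suc j m)))
    (trans
      (lemma₁ (leibniz (j ℕ.+ suc m)) (leibniz m) (sign m) (leibnizTerm m))
      (trans
        (cong (ℚ._+ sign m ℚ.* leibnizTerm m) (leibniz-difference (suc m) j))
        (lemma₂ (sign m) (alternating (suc m) j) (leibnizTerm m))))
    where
    open +-*-Solver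
    lemma₁ : ∀ a b s t → a ℚ.- b ≡ (a ℚ.- (b ℚ.+ s ℚ.* t)) ℚ.+ s ℚ.* t
    lemma₁ = solve 4 (λ a b s t → a :- b := (a :- (b :+ s :* t)) :+ s :* t) refl
    lemma₂ : ∀ s u t → (ℚ.- s) ℚ.* u ℚ.+ s ℚ.* t ≡ s ℚ.* (t ℚ.- u)
    lemma₂ = solve 3 (λ s u t → (:- s) :* u :+ s :* t := s :* (t :- u)) refl

  ∣sign∣ : ∀ m → ∣ sign m ∣ ≡ 1ℚ
  ∣sign∣ zero    = refl
  ∣sign∣ (suc m) = trans (ℚ.∣-p∣≡∣p∣ (sign m)) (∣sign∣ m)

  leibniz-cauchy-≤ : ∀ {m n} → m ℕ.≤ n →
                     ∣ leibniz n ℚ.- leibniz m ∣ ℚ.≤ leibnizTerm m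
  leibniz-cauchy-≤ {m} {n} m≤n = begin
    ∣ leibniz n ℚ.- leibniz m ∣
      ≡⟨ cong (λ k → ∣ leibniz k ℚ.- leibniz m ∣) (sym (ℕ.m∸n+n≡m m≤n)) ⟩
    ∣ leibniz (j ℕ.+ m) ℚ.- leibniz m ∣
      ≡⟨ cong ∣_∣ (leibniz-difference m j) ⟩
    ∣ sign m ℚ.* alternating m j ∣
      ≡⟨ ℚ.∣p*q∣≡∣p∣*∣q∣ (sign m) (alternating m j) ⟩
    ∣ sign m ∣ ℚ.* ∣ alternating m j ∣
      ≡⟨ cong₂ ℚ._*_ (∣sign∣ m)
           (ℚ.0≤p⇒∣p∣≡p (proj₁ (alternating-bounds m j))) ⟩
    1ℚ ℚ.* alternating m j
      ≡⟨ ℚ.*-identityˡ (alternating m j) ⟩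
    alternating m j
      ≤⟨ proj₂ (alternating-bounds m j) ⟩
    leibnizTerm m ∎
    where
    open ℚ.≤-Reasoning
    j = n ℕ.∸ m

  ∣-∣-sym : ∀ p q → ∣ p ℚ.- q ∣ ≡ ∣ q ℚ.- p ∣
  ∣-∣-sym p q = trans (cong ∣_∣ (lemma p q)) (ℚ.∣-p∣≡∣p∣ (q ℚ.- p))
    where
    open +-*-Solver
    lemma : ∀ p q → p ℚ.- q ≡ ℚ.- (q ℚ.- p)
    lemma = solve 2 (λ p q → p :- q := :- (q :- p)) refl

  leibniz-cauchy : ∀ ε → 0ℚ ℚ.< ε → ∃[ N ]
    (∀ m n → N ℕ.≤ m → N ℕ.≤ n → ∣ leibniz m ℚ.- leibniz n ∣ ℚ.< ε)
  leibniz-cauchy ε 0<ε = N , bound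
    where
    N = 2 ℕ.* ℚ.denominatorℕ ε

    ordered : ∀ {m n} → N ℕ.≤ m → m ℕ.≤ n → ∣ leibniz n ℚ.- leibniz m ∣ ℚ.< ε
    ordered N≤m m≤n = ℚ.≤-<-trans (leibniz-cauchy-≤ m≤n)
      (ℚ.≤-<-trans (leibnizTerm-antitone N≤m) (leibnizTerm-small ε 0<ε))

    bound : ∀ m n → N ℕ.≤ m → N ℕ.≤ n → ∣ leibniz m ℚ.- leibniz n ∣ ℚ.< ε
    bound m n N≤m N≤n with ℕ.≤-total m n
    ... | inj₁ m≤n = subst (ℚ._< ε) (∣-∣-sym (leibniz n) (leibniz m))
                       (ordered N≤m m≤n)
    ... | inj₂ n≤m = ordered N≤n n≤m

π : ℝ
π = mkℝ leibniz leibniz-cauchy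

2π : ℝ
2π = π + π

2π/3 : ℝ
2π/3 = (+ 2 ℚ./ 3) · π

------------------------------------------------------------------------
-- The dodecahedral pattern

Tile : Set
Tile = Fin 12

pattern P₁  = 0F
pattern P₂  = 1F
pattern P₃  = 2F
pattern P₄  = 3F
pattern P₅  = 4F
pattern P₆  = 5F
pattern P₇  = 6F
pattern P₈  = 7F
pattern P₉  = 8F
pattern P₁₀ = 9F
pattern P₁₁ = suc 9F
pattern P₁₂ = suc (suc 9F)

-- The index k of n_{k+1} in the list (n₁ , … , n₅) of a tile.
Position : Set
Position = Fin 5

next : Position → Position
next k = suc (toℕ k) mod 5

neighbours : Tile → Vec Tile 5
neighbours P₁  = P₂ ∷ P₃ ∷ P₄ ∷ P₅ ∷ P₆ ∷ []
neighbours P₂  = P₁ ∷ P₆ ∷ P₁₁ ∷ P₇ ∷ P₃ ∷ []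
neighbours P₃  = P₁ ∷ P₂ ∷ P₇ ∷ P₈ ∷ P₄ ∷ []
neighbours P₄  = P₁ ∷ P₃ ∷ P₈ ∷ P₉ ∷ P₅ ∷ []
neighbours P₅  = P₁ ∷ P₄ ∷ P₉ ∷ P₁₀ ∷ P₆ ∷ []
neighbours P₆  = P₁ ∷ P₅ ∷ P₁₀ ∷ P₁₁ ∷ P₂ ∷ []
neighbours P₇  = P₁₂ ∷ P₈ ∷ P₃ ∷ P₂ ∷ P₁₁ ∷ []
neighbours P₈  = P₁₂ ∷ P₉ ∷ P₄ ∷ P₃ ∷ P₇ ∷ []
neighbours P₉  = P₁₂ ∷ P₁₀ ∷ P₅ ∷ P₄ ∷ P₈ ∷ []
neighbours P₁₀ = P₁₂ ∷ P₁₁ ∷ P₆ ∷ P₅ ∷ P₉ ∷ []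
neighbours P₁₁ = P₁₂ ∷ P₇ ∷ P₂ ∷ P₆ ∷ P₁₀ ∷ []
neighbours P₁₂ = P₇ ∷ P₁₁ ∷ P₁₀ ∷ P₉ ∷ P₈ ∷ []

neighbour : Tile → Position → Tile
neighbour i k = lookup (neighbours i) k

Adjacent : Tile → Tile → Set
Adjacent i j = ∃[ k ] neighbour i k ≡ j

-- A vertex is identified with the set of the three tiles that share it.
Vertex : Set
Vertex = Subset 12

_≟ᵛ_ : DecidableEquality Vertex
_≟ᵛ_ = ≡-dec Bool._≟_

V : Tile → Tile → Tile → Vertex
V i j l = ⁅ i ⁆ ∪ ⁅ j ⁆ ∪ ⁅ l ⁆

-- (i , k) is the corner of the tile i between its edges at positions k
-- and next k.
Corner : Set
Corner = Tile × Position

corners : List Corner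
corners = cartesianProduct (allFin 12) (allFin 5)

vertex : Corner → Vertex
vertex (i , k) = V i (neighbour i k) (neighbour i (next k))

cornersAt : Vertex → List Corner
cornersAt v = filter (λ c → vertex c ≟ᵛ v) corners

------------------------------------------------------------------------
-- Angle congruent tilings

Angles : Set
Angles = Corner → ℝ

angleSum : Angles → Vertex → ℝ
angleSum t v = foldr _+_ 0ℝ (map t (cornersAt v))

-- The edges at positions e and f of a pentagon meet at its corner l.
Meet : Position → Position → Position → Set
Meet e f l = (e ≡ l × f ≡ next l) ⊎ (e ≡ next l × f ≡ l)

AngleCongruent : Angles → Tile → Tile → Set
AngleCongruent t i j =
  Σ[ φ ∈ Permutation′ 5 ] ∀ k →
    ∃[ l ] Meet (φ ⟨$⟩ʳ k) (φ ⟨$⟩ʳ next k) l × t (i , k) ≈ t (j , l)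

record IsAngleCongruentTiling (t : Angles) : Set where
  field
    vertexSum : ∀ c → angleSum t (vertex c) ≈ 2π
    congruent : ∀ i j → AngleCongruent t i j

-- The angles of the tile i are x₁ , … , x₅ in some order.
HasAngles : Angles → Tile → Vec ℝ 5 → Set
HasAngles t i xs =
  Σ[ ρ ∈ Permutation′ 5 ] ∀ k → t (i , ρ ⟨$⟩ʳ k) ≈ lookup xs k

------------------------------------------------------------------------
-- Angle words

data Letter : Set where
  α β γ : Letter

⟦_⟧ : Letter → ℝ → ℝ → ℝ → ℝ
⟦ α ⟧ x y z = x
⟦ β ⟧ x y z = y
⟦ γ ⟧ x y z = z

Words : Set
Words = Tile → Vec Letter 5

tilingI : Words
tilingI P₁  = γ ∷ α ∷ β ∷ β ∷ α ∷ []
tilingI P₂  = α ∷ γ ∷ α ∷ β ∷ β ∷ []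
tilingI P₃  = β ∷ β ∷ α ∷ γ ∷ α ∷ []
tilingI P₄  = α ∷ β ∷ β ∷ α ∷ γ ∷ []
tilingI P₅  = β ∷ α ∷ γ ∷ α ∷ β ∷ []
tilingI P₆  = γ ∷ α ∷ β ∷ β ∷ α ∷ []
tilingI P₇  = β ∷ α ∷ γ ∷ α ∷ β ∷ []
tilingI P₈  = α ∷ β ∷ β ∷ α ∷ γ ∷ []
tilingI P₉  = β ∷ β ∷ α ∷ γ ∷ α ∷ []
tilingI P₁₀ = α ∷ γ ∷ α ∷ β ∷ β ∷ []
tilingI P₁₁ = γ ∷ α ∷ β ∷ β ∷ α ∷ []
tilingI P₁₂ = β ∷ α ∷ γ ∷ α ∷ β ∷ []

tilingII : Words
tilingII P₁  = β ∷ α ∷ β ∷ γ ∷ α ∷ []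
tilingII P₂  = α ∷ β ∷ α ∷ β ∷ γ ∷ []
tilingII P₃  = β ∷ γ ∷ α ∷ β ∷ α ∷ []
tilingII P₄  = α ∷ β ∷ γ ∷ α ∷ β ∷ []
tilingII P₅  = γ ∷ α ∷ β ∷ α ∷ β ∷ []
tilingII P₆  = β ∷ α ∷ β ∷ γ ∷ α ∷ []
tilingII P₇  = γ ∷ α ∷ β ∷ α ∷ β ∷ []
tilingII P₈  = α ∷ β ∷ γ ∷ α ∷ β ∷ []
tilingII P₉  = β ∷ γ ∷ α ∷ β ∷ α ∷ []
tilingII P₁₀ = α ∷ β ∷ α ∷ β ∷ γ ∷ []
tilingII P₁₁ = β ∷ α ∷ β ∷ γ ∷ α ∷ []
tilingII P₁₂ = γ ∷ α ∷ β ∷ α ∷ β ∷ []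

swapβγ : Letter → Letter
swapβγ α = α
swapβγ β = γ
swapβγ γ = β

-- The ends of the edge between i and j are the vertices that contain
-- both i and j.
around : Tile × Tile → Corner → Bool
around (i , j) c@(p , _) =
  (does (p ≟ i) ∨ does (p ≟ j)) ∧ (lookup (vertex c) i ∧ lookup (vertex c) j)

exchange : Tile × Tile → Words → Words
exchange e w p = tabulate λ k →
  if around e (p , k) then swapβγ (lookup (w p) k) else lookup (w p) k

exchangeEdges : Vec (Tile × Tile) 6
exchangeEdges =
  (P₁ , P₅) ∷ (P₂ , P₃) ∷ (P₄ , P₈) ∷ (P₆ , P₁₁) ∷ (P₇ , P₁₂) ∷ (P₉ , P₁₀) ∷ []

-- S selects the edges around which β and γ are exchanged.
tilingIIExchanged : Subset 6 → Words
tilingIIExchanged S =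
  foldr′ (λ { (b , e) w → if b then exchange e w else w })
         tilingII (zip S exchangeEdges)

data Listed : Words → Set where
  I  : Listed tilingI
  II : ∀ S → Listed (tilingIIExchanged S)

------------------------------------------------------------------------
-- Symmetries of the dodecahedral pattern

-- The symmetries, reflections included, are the automorphisms of the
-- adjacency graph of the tiles.
record Symmetry : Set where
  field
    tiles    : Permutation′ 12
    adjacent : ∀ i j → Adjacent i j ⇔ Adjacent (tiles ⟨$⟩ʳ i) (tiles ⟨$⟩ʳ j)

  σ : Tile → Tile
  σ i = tiles ⟨$⟩ʳ i

-- The corner (σ i , l) is the image of the corner (i , k).
CornerImage : Symmetry → Tile → Position → Position → Set
CornerImage s i k l =
  vertex (σ i , l) ≡ V (σ i) (σ (neighbour i k)) (σ (neighbour i (next k)))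
  where open Symmetry s

-- A symmetry carries the words w, read with the angles x, y, z for the
-- letters α, β, γ, to the angles t.
GivenBy : ℝ → ℝ → ℝ → Angles → Words → Set
GivenBy x y z t w =
  Σ[ s ∈ Symmetry ] ∀ i k →
    ∃[ l ] CornerImage s i k l ×
           t (Symmetry.σ s i , l) ≈ ⟦ lookup (w i) k ⟧ x y z

-- The angles are α plus integer multiples ("excesses" 0, 1, −2) of β − α
-- once 2β + γ = 2π, which follows by adding up all the angles.  So the
-- angle sum at a vertex is 2π if and only if its excesses add up to 0,
-- which makes the theorem a statement about words.  As the tiles are
-- congruent, their words are the images of a single word under the
-- symmetries of the pentagon, and for each of the four possible words the
-- balanced choices of images form a finite search; its results are, up to
-- a rotation around P₁, the listed tilings.  Conversely, symmetries of the
-- pattern carry vertices to vertices and tiles to tiles, so it suffices to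
-- verify the listed words themselves.

{-# OPTIONS --safe #-}
module Submission where

open import Defs hiding (α; β; γ)
open import Data.Product using (_×_; ∃-syntax)
open import Data.Vec using (_∷_; [])
open import Function.Bundles using (_⇔_)
open import Relation.Nullary using (¬_)

open import Defs using () renaming (α to 𝛂; β to 𝛃; γ to 𝛄)
open import Algebra.Bundles using (CommutativeMonoid)
import Algebra.Properties.CommutativeMonoid.Sum
open import Data.Bool.Base using (true; false; if_then_else_; _∨_)
open import Data.Fin.Base using (Fin; zero; suc; toℕ)
open import Data.Fin.Patterns
open import Data.Fin.Permutation
  using (Permutation′; _⟨$⟩ʳ_; _⟨$⟩ˡ_; permutation; inverseˡ; inverseʳ; flip; _∘ₚ_)
open import Data.Fin.Properties using (_≟_; all?; any?)
open import Data.Fin.Subset using (Subset; ⁅_⁆; _∪_)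
open import Data.Integer.Base as ℤ using (ℤ; +_; -[1+_]; 0ℤ)
import Data.Integer.Properties as ℤ
open import Data.List.Base as List
  using (List; []; _∷_; _++_; allFin; cartesianProduct; cartesianProductWith;
         deduplicate; filter; foldr; length; map)
import Data.List.Membership.DecPropositional as DecMembership
open import Data.List.Membership.Propositional using (_∈_; find)
open import Data.List.Membership.Propositional.Properties
  using (∈-++⁺ˡ; ∈-++⁺ʳ; ∈-++⁻; ∈-allFin; ∈-cartesianProduct⁺; ∈-cartesianProductWith⁺;
         ∈-deduplicate⁺; ∈-deduplicate⁻; ∈-filter⁺; ∈-filter⁻; ∈-map⁺; ∈-map⁻)
import Data.List.Properties as List
open import Data.List.Relation.Unary.All as All using (All; []; _∷_)
open import Data.List.Relation.Unary.Any as Any using (Any; here; there)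
open import Data.Nat.Base as ℕ using (ℕ; zero; suc)
open import Data.Nat.GeneralisedArithmetic using (fold)
import Data.Nat.Properties as ℕ
open import Data.Product.Base using (Σ-syntax; _,_; proj₁; proj₂)
open import Data.Rational.Base as ℚ using (ℚ; 0ℚ; 1ℚ; ½; ∣_∣)
import Data.Rational.Properties as ℚ
import Data.Rational.Solver
import Data.Rational.Unnormalised.Base as ℚᵘ
import Data.Rational.Unnormalised.Properties as ℚᵘ
open import Data.Sum.Base using (inj₁; inj₂)
open import Data.Vec.Base as Vec using (Vec; lookup)
import Data.Vec.Properties as Vec
open import Function.Base using (_∘_; id)
open import Function.Bundles using (Equivalence; mk⇔)
open import Level using (0ℓ)
open import Relation.Binary.Definitions using (DecidableEquality)
open import Relation.Binary.PropositionalEquality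
  using (_≡_; _≢_; _≗_; refl; sym; trans; cong; cong₂; subst; subst₂)
open import Relation.Nullary using (Dec; contradiction; yes; no)
open import Relation.Nullary.Decidable
  using (does; does-⇔; from-yes; _×-dec_; _⊎-dec_; _→-dec_; ¬?)
open import Relation.Unary using (Pred; Decidable)

open Data.Rational.Solver.+-*-Solver using (solve; con; _:+_; _:*_; _:-_; _:=_)

-- Real numbers

-- The field of `x ≈ y` is `Null` of the termwise difference. Equations between reals are therefore
-- proved as linear combinations of null sequences, with the ring solver checking the combination.
Null : (ℕ → ℚ) → Set
Null f = ∀ ε → 0ℚ ℚ.< ε → ∃[ N ] (∀ n → N ℕ.≤ n → ∣ f n ∣ ℚ.< ε)

null-resp : ∀ {f g} → f ≗ g → Null f → Null g
null-resp f≗g f→0 ε 0<ε with f→0 ε 0<ε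
... | N , small = N , λ n N≤n → subst (λ q → ∣ q ∣ ℚ.< ε) (f≗g n) (small n N≤n)

null-0 : Null (λ _ → 0ℚ)
null-0 ε 0<ε = 0 , λ _ _ → 0<ε

null-+ : ∀ {f g} → Null f → Null g → Null (λ n → f n ℚ.+ g n)
null-+ {f} {g} f→0 g→0 ε 0<ε with f→0 (½ ℚ.* ε) 0<½ε | g→0 (½ ℚ.* ε) 0<½ε
  where 0<½ε = subst (ℚ._< ½ ℚ.* ε) (ℚ.*-zeroʳ ½) (ℚ.*-monoʳ-<-pos ½ 0<ε)
... | M , small-f | N , small-g = M ℕ.⊔ N , λ n ≤n → begin-strict
  ∣ f n ℚ.+ g n ∣
    ≤⟨ ℚ.∣p+q∣≤∣p∣+∣q∣ (f n) (g n) ⟩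
  ∣ f n ∣ ℚ.+ ∣ g n ∣
    <⟨ ℚ.+-mono-< (small-f n (ℕ.m⊔n≤o⇒m≤o M N ≤n)) (small-g n (ℕ.m⊔n≤o⇒n≤o M N ≤n)) ⟩
  ½ ℚ.* ε ℚ.+ ½ ℚ.* ε
    ≡⟨ ℚ.*-distribʳ-+ ε ½ ½ ⟨
  1ℚ ℚ.* ε
    ≡⟨ ℚ.*-identityˡ ε ⟩
  ε ∎
  where open ℚ.≤-Reasoning

null-* : ∀ q {f} → Null f → Null (λ n → q ℚ.* f n)
null-* q {f} f→0 with q ℚ.≟ 0ℚ
... | yes refl = null-resp (λ n → sym (ℚ.*-zeroˡ (f n))) null-0
... | no q≢0 = bound
  where
  instance
    ∣q∣-nonZero : ℚ.NonZero ∣ q ∣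
    ∣q∣-nonZero = ℚ.≢-nonZero λ ∣q∣≡0 → q≢0 (ℚ.∣p∣≡0⇒p≡0 q ∣q∣≡0)

    ∣q∣-positive : ℚ.Positive ∣ q ∣
    ∣q∣-positive = ℚ.nonNeg∧nonZero⇒pos ∣ q ∣ {{ℚ.∣-∣-nonNeg q}}

    1/∣q∣-positive : ℚ.Positive (ℚ.1/ ∣ q ∣)
    1/∣q∣-positive = ℚ.1/pos⇒pos ∣ q ∣

  bound : Null (λ n → q ℚ.* f n)
  bound ε 0<ε with f→0 (ℚ.1/ ∣ q ∣ ℚ.* ε)
                     (subst (ℚ._< ℚ.1/ ∣ q ∣ ℚ.* ε) (ℚ.*-zeroʳ (ℚ.1/ ∣ q ∣))
                       (ℚ.*-monoʳ-<-pos (ℚ.1/ ∣ q ∣) 0<ε))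
  ... | N , small = N , λ n N≤n → begin-strict
    ∣ q ℚ.* f n ∣                       ≡⟨ ℚ.∣p*q∣≡∣p∣*∣q∣ q (f n) ⟩
    ∣ q ∣ ℚ.* ∣ f n ∣                   <⟨ ℚ.*-monoʳ-<-pos ∣ q ∣ (small n N≤n) ⟩
    ∣ q ∣ ℚ.* (ℚ.1/ ∣ q ∣ ℚ.* ε)        ≡⟨ ℚ.*-assoc ∣ q ∣ (ℚ.1/ ∣ q ∣) ε ⟨
    (∣ q ∣ ℚ.* ℚ.1/ ∣ q ∣) ℚ.* ε        ≡⟨ cong (ℚ._* ε) (ℚ.*-inverseʳ ∣ q ∣) ⟩
    1ℚ ℚ.* ε                            ≡⟨ ℚ.*-identityˡ ε ⟩
    ε                                   ∎
    where open ℚ.≤-Reasoning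

-- Used to conclude `A ≈ B` when a nonzero multiple of `b - a` tends to zero.
null-cancel : ∀ q {f} → q ≢ 0ℚ → Null (λ n → q ℚ.* f n) → Null f
null-cancel q {f} q≢0 qf→0 = null-resp unscale (null-* (ℚ.1/ q) qf→0)
  where
  instance
    q-nonZero : ℚ.NonZero q
    q-nonZero = ℚ.≢-nonZero q≢0

  unscale : ∀ n → ℚ.1/ q ℚ.* (q ℚ.* f n) ≡ f n
  unscale n = trans (sym (ℚ.*-assoc (ℚ.1/ q) q (f n)))
    (trans (cong (ℚ._* f n) (ℚ.*-inverseˡ q)) (ℚ.*-identityˡ (f n)))

pointwise : ∀ {x y} → seq x ≗ seq y → x ≈ y
pointwise {x} {y} x≗y = mk≈ (null-resp
  (λ n → sym (trans (cong (ℚ._- seq y n) (x≗y n)) (ℚ.+-inverseʳ (seq y n)))) null-0)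

≈-refl : ∀ {x} → x ≈ x
≈-refl {x} = pointwise {x} {x} λ _ → refl

≈-sym : ∀ {x y} → x ≈ y → y ≈ x
≈-sym {x} {y} (mk≈ x-y→0) = mk≈ (null-resp
  (λ n → solve 2 (λ x y → con (ℚ.- 1ℚ) :* (x :- y) := y :- x) refl (seq x n) (seq y n))
  (null-* (ℚ.- 1ℚ) x-y→0))

≈-trans : ∀ {x y z} → x ≈ y → y ≈ z → x ≈ z
≈-trans {x} {y} {z} (mk≈ x-y→0) (mk≈ y-z→0) = mk≈ (null-resp
  (λ n → solve 3 (λ x y z → (x :- y) :+ (y :- z) := x :- z) refl
    (seq x n) (seq y n) (seq z n))
  (null-+ x-y→0 y-z→0))

+-cong : ∀ {x y u v} → x ≈ y → u ≈ v → x + u ≈ y + v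
+-cong {x} {y} {u} {v} (mk≈ x-y→0) (mk≈ u-v→0) = mk≈ (null-resp
  (λ n → solve 4 (λ x y u v → (x :- y) :+ (u :- v) := (x :+ u) :- (y :+ v)) refl
    (seq x n) (seq y n) (seq u n) (seq v n))
  (null-+ x-y→0 u-v→0))

+-0-commutativeMonoid : CommutativeMonoid _ _
+-0-commutativeMonoid = record
  { Carrier = ℝ
  ; _≈_     = _≈_
  ; _∙_     = _+_
  ; ε       = 0ℝ
  ; isCommutativeMonoid = record
    { isMonoid = record
      { isSemigroup = record
        { isMagma = record
          { isEquivalence = record { refl = ≈-refl ; sym = ≈-sym ; trans = ≈-trans }
          ; ∙-cong        = +-cong
          }
        ; assoc = λ x y z → pointwise {x + y + z} {x + (y + z)} λ n → ℚ.+-assoc (seq x n) (seq y n) (seq z n)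
        }
      ; identity = (λ x → pointwise {0ℝ + x} {x} λ n → ℚ.+-identityˡ (seq x n)) ,
                   (λ x → pointwise {x + 0ℝ} {x} λ n → ℚ.+-identityʳ (seq x n))
      }
    ; comm = λ x y → pointwise {x + y} {y + x} λ n → ℚ.+-comm (seq x n) (seq y n)
    }
  }

-- Angle sums in terms of integer excesses

fromℤ : ℤ → ℚ
fromℤ z = z ℚ./ 1

fromℤ-+ : ∀ y z → fromℤ (y ℤ.+ z) ≡ fromℤ y ℚ.+ fromℤ z
fromℤ-+ y z = ℚ.toℚᵘ-injective (begin
  ℚ.toℚᵘ (fromℤ (y ℤ.+ z))                   ≈⟨ ℚ.toℚᵘ-fromℚᵘ _ ⟩
  ℚᵘ.mkℚᵘ (y ℤ.+ z) 0
    ≡⟨ cong (λ x → ℚᵘ.mkℚᵘ x 0) (cong₂ ℤ._+_ (ℤ.*-identityʳ y) (ℤ.*-identityʳ z)) ⟨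
  ℚᵘ.mkℚᵘ y 0 ℚᵘ.+ ℚᵘ.mkℚᵘ z 0
    ≈⟨ ℚᵘ.+-cong (ℚ.toℚᵘ-fromℚᵘ (ℚᵘ.mkℚᵘ y 0)) (ℚ.toℚᵘ-fromℚᵘ (ℚᵘ.mkℚᵘ z 0)) ⟨
  ℚ.toℚᵘ (fromℤ y) ℚᵘ.+ ℚ.toℚᵘ (fromℤ z)     ≈⟨ ℚ.toℚᵘ-homo-+ (fromℤ y) (fromℤ z) ⟨
  ℚ.toℚᵘ (fromℤ y ℚ.+ fromℤ z)               ∎)
  where open import Relation.Binary.Reasoning.Setoid ℚᵘ.≃-setoid

fromℤ≡0 : ∀ z → fromℤ z ≡ 0ℚ → z ≡ 0ℤ
fromℤ≡0 z z≡0 with ℚᵘ.≃-trans (ℚᵘ.≃-sym (ℚ.toℚᵘ-fromℚᵘ (ℚᵘ.mkℚᵘ z 0))) (ℚᵘ.≃-reflexive (cong ℚ.toℚᵘ z≡0))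
... | ℚᵘ.*≡* z*1≡0 = trans (sym (ℤ.*-identityʳ z)) z*1≡0

-- As 2β + γ = 3α, every angle is α plus a multiple of β − α; this is
-- the multiple.
excess : Letter → ℤ
excess 𝛂 = + 0
excess 𝛃 = + 1
excess 𝛄 = -[1+ 1 ]

3α≈2π : ∀ {A} → A ≈ 2π/3 → Null (λ n → (seq A n ℚ.+ (seq A n ℚ.+ seq A n)) ℚ.- seq 2π n)
3α≈2π {A} A≈2π/3 = null-resp
  (λ n → solve 2 (λ a p → con (+ 3 ℚ./ 1) :* (a :- con (+ 2 ℚ./ 3) :* p) :=
                          (a :+ (a :+ a)) :- (p :+ p)) refl (seq A n) (seq π n))
  (null-* (+ 3 ℚ./ 1) (close A≈2π/3))

module Excess {A B C : ℝ} (A≈2π/3 : A ≈ 2π/3) (2B+C≈2π : B + B + C ≈ 2π) where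

  private
    a = seq A
    b = seq B
    c = seq C
    p = seq π

  letter-excess : ∀ x → Null (λ n → seq (⟦ x ⟧ A B C) n ℚ.-
                                    (a n ℚ.+ fromℤ (excess x) ℚ.* (b n ℚ.- a n)))
  letter-excess 𝛂 = null-resp
    (λ n → solve 2 (λ a b → con 0ℚ := a :- (a :+ con (fromℤ (+ 0)) :* (b :- a)))
             refl (a n) (b n)) null-0
  letter-excess 𝛃 = null-resp
    (λ n → solve 2 (λ a b → con 0ℚ := b :- (a :+ con (fromℤ (+ 1)) :* (b :- a)))
             refl (a n) (b n)) null-0
  -- Here c - (a - 2(b - a)) = (2b + c - 2π) - (3a - 2π), a difference of two null sequences.
  letter-excess 𝛄 = null-resp
    (λ n → solve 4 (λ a b c p →
      ((b :+ b :+ c) :- (p :+ p)) :+ con (ℚ.- 1ℚ) :* ((a :+ (a :+ a)) :- (p :+ p)) :=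
      c :- (a :+ con (fromℤ -[1+ 1 ]) :* (b :- a)))
             refl (a n) (b n) (c n) (p n))
    (null-+ (close 2B+C≈2π) (null-* (ℚ.- 1ℚ) (3α≈2π A≈2π/3)))

  module _ {X : Set} {f : X → ℝ} {letter : X → Letter} (f≈ : ∀ x → f x ≈ ⟦ letter x ⟧ A B C) where

    private
      Σf : List X → ℕ → ℚ
      Σf xs = seq (foldr _+_ 0ℝ (map f xs))

      E : List X → ℤ
      E xs = foldr ℤ._+_ 0ℤ (map (excess ∘ letter) xs)

      sum-excess : ∀ xs → Null (λ n → Σf xs n ℚ.-
        (fromℤ (+ length xs) ℚ.* a n ℚ.+ fromℤ (E xs) ℚ.* (b n ℚ.- a n)))
      sum-excess [] = null-resp
        (λ n → solve 2 (λ a b → con 0ℚ :=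
          con 0ℚ :- (con (fromℤ (+ 0)) :* a :+ con (fromℤ (+ 0)) :* (b :- a))) refl (a n) (b n))
        null-0
      sum-excess (x ∷ xs) = null-resp
        (λ n → trans
          (solve 8 (λ a b u v e s l E →
            (u :- v) :+ (v :- (a :+ e :* (b :- a))) :+ (s :- (l :* a :+ E :* (b :- a))) :=
            (u :+ s) :- ((con (fromℤ (+ 1)) :+ l) :* a :+ (e :+ E) :* (b :- a))) refl
            (a n) (b n) (seq (f x) n) (seq (⟦ letter x ⟧ A B C) n) (fromℤ (excess (letter x)))
            (Σf xs n) (fromℤ (+ length xs)) (fromℤ (E xs)))
          (cong₂ (λ l e → Σf (x ∷ xs) n ℚ.- (l ℚ.* a n ℚ.+ e ℚ.* (b n ℚ.- a n)))
            (sym (fromℤ-+ (+ 1) (+ length xs))) (sym (fromℤ-+ (excess (letter x)) (E xs)))))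
        (null-+ (null-+ (close (f≈ x)) (letter-excess (letter x))) (sum-excess xs))

      -- Three terms contribute `3a`, which cancels 2π, so the defect of the sum is the total excess
      -- times `b - a`. Both directions of the balance criterion follow from this.
      sum3-excess : ∀ xs → length xs ≡ 3 →
        Null (λ n → (Σf xs n ℚ.- seq 2π n) ℚ.- fromℤ (E xs) ℚ.* (b n ℚ.- a n))
      sum3-excess xs ∣xs∣≡3 = null-resp
        (λ n → trans
          (cong (λ l → (Σf xs n ℚ.- (fromℤ (+ l) ℚ.* a n ℚ.+ fromℤ (E xs) ℚ.* (b n ℚ.- a n))) ℚ.+
                       ((a n ℚ.+ (a n ℚ.+ a n)) ℚ.- (p n ℚ.+ p n))) ∣xs∣≡3)
          (solve 5 (λ a b s E p →
            (s :- (con (fromℤ (+ 3)) :* a :+ E :* (b :- a))) :+ ((a :+ (a :+ a)) :- (p :+ p)) :=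
            (s :- (p :+ p)) :- E :* (b :- a)) refl (a n) (b n) (Σf xs n) (fromℤ (E xs)) (p n)))
        (null-+ (sum-excess xs) (3α≈2π A≈2π/3))

    balanced⇒2π : ∀ xs → length xs ≡ 3 → foldr ℤ._+_ 0ℤ (map (excess ∘ letter) xs) ≡ 0ℤ →
                  foldr _+_ 0ℝ (map f xs) ≈ 2π
    balanced⇒2π xs ∣xs∣≡3 balanced = mk≈ (null-resp
      (λ n → trans
        (cong (λ e → (Σf xs n ℚ.- seq 2π n) ℚ.- fromℤ e ℚ.* (b n ℚ.- a n)) balanced)
        (solve 2 (λ s d → s :- con (fromℤ 0ℤ) :* d := s) refl (Σf xs n ℚ.- seq 2π n) (b n ℚ.- a n)))
      (sum3-excess xs ∣xs∣≡3))

    -- A nonzero excess could be divided out of the null sequence `E xs * (b - a)`, forcing `A ≈ B`.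
    -- The case distinction is on an integer, so it is constructive.
    2π⇒balanced : ¬ (A ≈ B) → ∀ xs → length xs ≡ 3 → foldr _+_ 0ℝ (map f xs) ≈ 2π →
                  foldr ℤ._+_ 0ℤ (map (excess ∘ letter) xs) ≡ 0ℤ
    2π⇒balanced A≉B xs ∣xs∣≡3 sum≈2π with E xs ℤ.≟ 0ℤ
    ... | yes e≡0 = e≡0
    ... | no  e≢0 = contradiction
      (≈-sym {B} {A} (mk≈ (null-cancel (fromℤ (E xs)) (λ e≡0 → e≢0 (fromℤ≡0 _ e≡0))
        (null-resp
          (λ n → solve 2 (λ s t → s :+ con (ℚ.- 1ℚ) :* (s :- t) := t) refl
            (Σf xs n ℚ.- seq 2π n) (fromℤ (E xs) ℚ.* (b n ℚ.- a n)))
          (null-+ (close sum≈2π) (null-* (ℚ.- 1ℚ) (sum3-excess xs ∣xs∣≡3)))))))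
      A≉B

-- Sums over the corners

vertex-degree : ∀ c → length (cornersAt (vertex c)) ≡ 3
vertex-degree (i , k) = from-yes (all? λ i → all? λ k →
  length (cornersAt (vertex (i , k))) ℕ.≟ 3) i k

-- The monoid is abstract because comparing real sums would make Agda unfold
-- their Cauchy moduli.
module CornerSums (M : CommutativeMonoid 0ℓ 0ℓ) where
  open CommutativeMonoid M
    renaming (Carrier to R; _≈_ to _≃_; refl to ≃-refl; sym to ≃-sym; trans to ≃-trans;
              reflexive to ≃-reflexive)
  open Algebra.Properties.CommutativeMonoid.Sum M public
    using (sum; sum-cong-≋; sum-permute; ∑-comm)
  open import Relation.Binary.Reasoning.Setoid setoid

  sumᴸ : List R → R
  sumᴸ = foldr _∙_ ε

  ∑∑ : ∀ {m n} → (Fin m × Fin n → R) → R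
  ∑∑ t = sum λ i → sum λ k → t (i , k)

  ∑∑-cong : ∀ {m n} {t u : Fin m × Fin n → R} → (∀ c → t c ≃ u c) → ∑∑ t ≃ ∑∑ u
  ∑∑-cong t≃u = sum-cong-≋ λ i → sum-cong-≋ λ k → t≃u (i , k)

  -- An indicator: it turns the sum over the corners at a vertex into a sum over all corners, where
  -- summations can be interchanged and reindexed.
  only : ∀ {P : Set} → Dec P → R → R
  only p? x = if does p? then x else ε

  only-cong : ∀ {P Q : Set} {p? : Dec P} {q? : Dec Q} {x y} →
              P ⇔ Q → x ≃ y → only p? x ≃ only q? y
  only-cong {p? = yes _} {yes _} _   x≃y = x≃y
  only-cong {p? = no _}  {no _}  _   _   = ≃-refl
  only-cong {p? = yes p} {no ¬q} P⇔Q _   = contradiction (Equivalence.to P⇔Q p) ¬q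
  only-cong {p? = no ¬p} {yes q} P⇔Q _   = contradiction (Equivalence.from P⇔Q q) ¬p

  sumᴸ-++ : ∀ xs ys → sumᴸ (xs ++ ys) ≃ sumᴸ xs ∙ sumᴸ ys
  sumᴸ-++ []       ys = ≃-sym (identityˡ (sumᴸ ys))
  sumᴸ-++ (x ∷ xs) ys = ≃-trans (∙-congˡ (sumᴸ-++ xs ys)) (≃-sym (assoc x (sumᴸ xs) (sumᴸ ys)))

  sumᴸ-filter : ∀ {A : Set} {P : Pred A 0ℓ} (P? : Decidable P) (f : A → R) xs →
                sumᴸ (map f (filter P? xs)) ≃ sumᴸ (map (λ x → only (P? x) (f x)) xs)
  sumᴸ-filter P? f []       = ≃-refl
  sumᴸ-filter P? f (x ∷ xs) with P? x
  ... | yes _ = ∙-congˡ (sumᴸ-filter P? f xs)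
  ... | no  _ = ≃-trans (sumᴸ-filter P? f xs) (≃-sym (identityˡ _))

  sumᴸ-product : ∀ {A B : Set} (f : A × B → R) xs ys →
    sumᴸ (map f (cartesianProduct xs ys)) ≃
    sumᴸ (map (λ x → sumᴸ (map (λ y → f (x , y)) ys)) xs)
  sumᴸ-product f []       ys = ≃-refl
  sumᴸ-product f (x ∷ xs) ys = begin
    sumᴸ (map f (map (x ,_) ys ++ cartesianProduct xs ys))
      ≡⟨ cong sumᴸ (List.map-++ f (map (x ,_) ys) (cartesianProduct xs ys)) ⟩
    sumᴸ (map f (map (x ,_) ys) ++ map f (cartesianProduct xs ys))
      ≈⟨ sumᴸ-++ (map f (map (x ,_) ys)) (map f (cartesianProduct xs ys)) ⟩
    sumᴸ (map f (map (x ,_) ys)) ∙ sumᴸ (map f (cartesianProduct xs ys))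
      ≡⟨ cong (λ zs → sumᴸ zs ∙ sumᴸ (map f (cartesianProduct xs ys))) (List.map-∘ ys) ⟨
    sumᴸ (map (λ y → f (x , y)) ys) ∙ sumᴸ (map f (cartesianProduct xs ys))
      ≈⟨ ∙-congˡ (sumᴸ-product f xs ys) ⟩
    sumᴸ (map (λ x → sumᴸ (map (λ y → f (x , y)) ys)) (x ∷ xs)) ∎

  sumᴸ-tabulate : ∀ {n} (f : Fin n → R) → sumᴸ (List.tabulate f) ≡ sum f
  sumᴸ-tabulate {zero}  f = refl
  sumᴸ-tabulate {suc n} f = cong (f zero ∙_) (sumᴸ-tabulate (f ∘ suc))

  sumᴸ-allFin : ∀ {n} (f : Fin n → R) → sumᴸ (map f (allFin n)) ≡ sum f
  sumᴸ-allFin f = trans (cong sumᴸ (List.map-tabulate id f)) (sumᴸ-tabulate f)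

  sumᴸ-∑∑ : ∀ {m n} (t : Fin m × Fin n → R) →
            sumᴸ (map t (cartesianProduct (allFin m) (allFin n))) ≃ ∑∑ t
  sumᴸ-∑∑ {m} {n} t = begin
    sumᴸ (map t (cartesianProduct (allFin m) (allFin n)))
      ≈⟨ sumᴸ-product t (allFin m) (allFin n) ⟩
    sumᴸ (map (λ i → sumᴸ (map (λ k → t (i , k)) (allFin n))) (allFin m))
      ≡⟨ sumᴸ-allFin (λ i → sumᴸ (map (λ k → t (i , k)) (allFin n))) ⟩
    sum (λ i → sumᴸ (map (λ k → t (i , k)) (allFin n)))
      ≈⟨ sum-cong-≋ (λ i → ≃-reflexive (sumᴸ-allFin λ k → t (i , k))) ⟩
    ∑∑ t ∎

  ∑∑-comm : ∀ {m n p q} (f : Fin m × Fin n → Fin p × Fin q → R) →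
            ∑∑ (λ c → ∑∑ (f c)) ≃ ∑∑ (λ d → ∑∑ (λ c → f c d))
  ∑∑-comm f = begin
    (sum λ i → sum λ k → sum λ j → sum λ l → f (i , k) (j , l))
      ≈⟨ (sum-cong-≋ λ i → ∑-comm λ k j → sum λ l → f (i , k) (j , l)) ⟩
    (sum λ i → sum λ j → sum λ k → sum λ l → f (i , k) (j , l))
      ≈⟨ (∑-comm λ i j → sum λ k → sum λ l → f (i , k) (j , l)) ⟩
    (sum λ j → sum λ i → sum λ k → sum λ l → f (i , k) (j , l))
      ≈⟨ (sum-cong-≋ λ j → sum-cong-≋ λ i → ∑-comm λ k l → f (i , k) (j , l)) ⟩
    (sum λ j → sum λ i → sum λ l → sum λ k → f (i , k) (j , l))
      ≈⟨ (sum-cong-≋ λ j → ∑-comm λ i l → sum λ k → f (i , k) (j , l)) ⟩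
    (sum λ j → sum λ l → sum λ i → sum λ k → f (i , k) (j , l)) ∎

  -- The inner permutation may depend on the tile, because a symmetry of the pattern acts on the
  -- positions of each tile in its own way.
  ∑∑-permute : ∀ {m n} t (σ : Permutation′ m) (τ : Fin m → Permutation′ n) →
               ∑∑ t ≃ ∑∑ (λ (i , k) → t (σ ⟨$⟩ʳ i , τ i ⟨$⟩ʳ k))
  ∑∑-permute t σ τ = ≃-trans (sum-permute (λ i → sum λ k → t (i , k)) σ)
    (sum-cong-≋ λ i → sum-permute (λ k → t (σ ⟨$⟩ʳ i , k)) (τ i))

  vertexSum : (Corner → R) → Vertex → R
  vertexSum t v = sumᴸ (map t (cornersAt v))

  vertexSum-∑ : ∀ t v → vertexSum t v ≃ ∑∑ (λ c → only (vertex c ≟ᵛ v) (t c))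
  vertexSum-∑ t v = ≃-trans (sumᴸ-filter (λ c → vertex c ≟ᵛ v) t corners)
    (sumᴸ-∑∑ λ c → only (vertex c ≟ᵛ v) (t c))

  -- Spelled as the right fold over three equal entries unfolds, so that `constant` below holds by
  -- `refl`.
  triple : R → R
  triple x = x ∙ (x ∙ (x ∙ ε))

  triple-cong : ∀ {x y} → x ≃ y → triple x ≃ triple y
  triple-cong x≃y = ∙-cong x≃y (∙-cong x≃y (∙-congʳ x≃y))

  -- Double counting: each corner lies at the vertices of three corners.
  ∑-vertexSum : ∀ t → ∑∑ (λ c → vertexSum t (vertex c)) ≃ ∑∑ (λ d → triple (t d))
  ∑-vertexSum t = begin
    ∑∑ (λ c → vertexSum t (vertex c))
      ≈⟨ ∑∑-cong (λ c → vertexSum-∑ t (vertex c)) ⟩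
    ∑∑ (λ c → ∑∑ λ d → only (vertex d ≟ᵛ vertex c) (t d))
      ≈⟨ ∑∑-comm (λ c d → only (vertex d ≟ᵛ vertex c) (t d)) ⟩
    ∑∑ (λ d → ∑∑ λ c → only (vertex d ≟ᵛ vertex c) (t d))
      -- Reading the incidence from the side of `d` makes the inner sum a vertex sum again, now of
      -- the constant `t d`.
      ≈⟨ ∑∑-cong (λ d → ∑∑-cong λ c →
           only-cong {p? = vertex d ≟ᵛ vertex c} {vertex c ≟ᵛ vertex d} {t d} {t d}
             (mk⇔ sym sym) ≃-refl) ⟩
    ∑∑ (λ d → ∑∑ λ c → only (vertex c ≟ᵛ vertex d) (t d))
      ≈⟨ ∑∑-cong (λ d → vertexSum-∑ (λ _ → t d) (vertex d)) ⟨
    ∑∑ (λ d → vertexSum (λ _ → t d) (vertex d))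
      ≈⟨ ∑∑-cong (λ d → ≃-reflexive (constant (t d) (cornersAt (vertex d)) (vertex-degree d))) ⟩
    ∑∑ (λ d → triple (t d)) ∎
    where
    constant : ∀ x cs → length cs ≡ 3 → sumᴸ (map {A = Corner} (λ _ → x) cs) ≡ triple x
    constant x (_ ∷ _ ∷ _ ∷ []) refl = refl

  -- Sums the 60 vertex equations, one per corner. By double counting every angle occurs three
  -- times, and within each tile the angles can be reordered to `xs`.
  ∑-vertexSum-tiles : ∀ {t : Corner → R} {x} (xs : Position → R) → (∀ c → vertexSum t (vertex c) ≃ x) →
    (∀ i → Σ[ ρ ∈ Permutation′ 5 ] ∀ k → t (i , ρ ⟨$⟩ʳ k) ≃ xs k) →
    ∑∑ {12} {5} (λ _ → x) ≃ sum {12} (λ _ → sum λ k → triple (xs k))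
  ∑-vertexSum-tiles {t} {x} xs sums tiles = begin
    ∑∑ {12} {5} (λ _ → x)                       ≈⟨ ∑∑-cong sums ⟨
    ∑∑ (λ c → vertexSum t (vertex c))  ≈⟨ ∑-vertexSum t ⟩
    ∑∑ (λ d → triple (t d))
      ≈⟨ sum-cong-≋ (λ i → ≃-trans
           (sum-permute (λ k → triple (t (i , k))) (proj₁ (tiles i)))
           (sum-cong-≋ λ k → triple-cong (proj₂ (tiles i) k))) ⟩
    sum {12} (λ _ → sum λ k → triple (xs k)) ∎

-- The total over all corners reads 60 · 2π = 36 (2α + 2β + γ), so a pentagon has angle sum 10π/3;
-- taking away 2α = 4π/3 leaves 2π.
2β+γ≈2π : ∀ {A B C} → A ≈ 2π/3 → ∀ t → (∀ c → angleSum t (vertex c) ≈ 2π) →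
          (∀ i → HasAngles t i (A ∷ A ∷ B ∷ B ∷ C ∷ [])) → B + B + C ≈ 2π
2β+γ≈2π {A} {B} {C} A≈2π/3 t sums angles = mk≈ (null-resp
  (λ n → solve 4 (λ a b c p →
    con ((ℤ.- (+ 1)) ℚ./ 36) :*
      (con (+ 60 ℚ./ 1) :* (p :+ p) :- con (+ 36 ℚ./ 1) :* (a :+ a :+ b :+ b :+ c)) :+
    con ((ℤ.- (+ 2)) ℚ./ 3) :* ((a :+ (a :+ a)) :- (p :+ p)) :=
    (b :+ b :+ c) :- (p :+ p)) refl (seq A n) (seq B n) (seq C n) (seq π n))
  -- The factor -1/36 scales the total to a single pentagon, and -2/3 turns 3α - 2π into the
  -- correction that removes 2α.
  (null-+ (null-* ((ℤ.- (+ 1)) ℚ./ 36) (null-resp expand (close total)))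
          (null-* ((ℤ.- (+ 2)) ℚ./ 3) (3α≈2π {A} A≈2π/3))))
  where
  open CornerSums +-0-commutativeMonoid

  xs = A ∷ A ∷ B ∷ B ∷ C ∷ []

  total = ∑-vertexSum-tiles {t} {2π} (lookup xs) sums angles

  sum-const : ∀ x n → seq (sum {12} λ _ → x) n ≡ (+ 12 ℚ./ 1) ℚ.* seq x n
  sum-const x n = solve 1 (λ x →
    x :+ (x :+ (x :+ (x :+ (x :+ (x :+ (x :+ (x :+ (x :+ (x :+ (x :+ (x :+ con 0ℚ)))))))))))
    := con (+ 12 ℚ./ 1) :* x) refl (seq x n)

  expand : ∀ n → _ ≡
    (+ 60 ℚ./ 1) ℚ.* (seq π n ℚ.+ seq π n) ℚ.-
    (+ 36 ℚ./ 1) ℚ.* (seq A n ℚ.+ seq A n ℚ.+ seq B n ℚ.+ seq B n ℚ.+ seq C n)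
  expand n = trans
    (cong₂ ℚ._-_ (sum-const (sum {5} λ _ → 2π) n) (sum-const (sum λ k → triple (lookup xs k)) n))
    (solve 4 (λ a b c p →
      let triple′ = λ x → x :+ (x :+ (x :+ con 0ℚ)) in
      con (+ 12 ℚ./ 1) :* ((p :+ p) :+ ((p :+ p) :+ ((p :+ p) :+ ((p :+ p) :+
        ((p :+ p) :+ con 0ℚ))))) :-
      con (+ 12 ℚ./ 1) :* (triple′ a :+ (triple′ a :+ (triple′ b :+ (triple′ b :+
        (triple′ c :+ con 0ℚ))))) :=
      con (+ 60 ℚ./ 1) :* (p :+ p) :- con (+ 36 ℚ./ 1) :* (a :+ a :+ b :+ b :+ c))
      refl (seq A n) (seq B n) (seq C n) (seq π n))

-- Symmetries of the pentagon

prev : Position → Position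
prev 0F = 4F
prev 1F = 0F
prev 2F = 1F
prev 3F = 2F
prev 4F = 3F

prev-next : ∀ k → prev (next k) ≡ k
prev-next = from-yes (all? λ k → prev (next k) ≟ k)

next-injective : ∀ {k l} → next k ≡ next l → k ≡ l
next-injective {k} {l} eq = trans (sym (prev-next k)) (trans (cong prev eq) (prev-next l))

next-fixes-none : ∀ k → next k ≢ k
next-fixes-none = from-yes (all? λ k → ¬? (next k ≟ k))

next²-fixes-none : ∀ k → next (next k) ≢ k
next²-fixes-none = from-yes (all? λ k → ¬? (next (next k) ≟ k))

-- The symmetries of the corners of a pentagon: the rotations act 0F b
-- and the reflections act 1F b.
act : Fin 2 → Position → Position → Position
act 0F b k = fold b next (toℕ k)
act 1F b k = fold b prev (toℕ k)

-- With `next` or `prev` for `f`, this identifies a map as a rotation `act 0F` or a reflection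
-- `act 1F`.
fold-step : ∀ (f l : Position → Position) →
            (∀ k → l (next k) ≡ f (l k)) → ∀ k → l k ≡ fold (l 0F) f (toℕ k)
fold-step f l step = λ { 0F → refl ; 1F → at₁ ; 2F → at₂ ; 3F → at₃ ; 4F → at₄ }
  where
  at₁ = step 0F
  at₂ = trans (step 1F) (cong f at₁)
  at₃ = trans (step 2F) (cong f at₂)
  at₄ = trans (step 3F) (cong f at₃)

next-induction : ∀ (P : Position → Set) → P 0F → (∀ k → P k → P (next k)) → ∀ k → P k
next-induction P at₀ step = λ { 0F → at₀ ; 1F → at₁ ; 2F → at₂ ; 3F → at₃ ; 4F → at₄ }
  where
  at₁ = step 0F at₀
  at₂ = step 1F at₁
  at₃ = step 2F at₂
  at₄ = step 3F at₃

-- An injective adjacency-preserving map of edges keeps or reverses the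
-- orientation everywhere, so it is induced by a symmetry.
Meet⇒act : ∀ {φ l : Position → Position} → (∀ {j k} → φ j ≡ φ k → j ≡ k) →
           (∀ k → Meet (φ k) (φ (next k)) (l k)) → ∃[ r ] ∃[ b ] (∀ k → l k ≡ act r b k)
Meet⇒act {φ} {l} injective meet with meet 0F
... | inj₁ keep₀ = 0F , l 0F , fold-step next l λ k →
        trans (sym (proj₁ (keep (next k)))) (proj₂ (keep k))
  where
  Keep : Position → Set
  Keep k = φ k ≡ l k × φ (next k) ≡ next (l k)

  step : ∀ k → Keep k → Keep (next k)
  step k (φk , φk⁺) with meet (next k)
  ... | inj₁ keep          = keep
  -- A change of orientation here would give the edges `k` and `next (next k)` the same image under
  -- `φ`.
  ... | inj₂ (φk⁺′ , φk⁺⁺) = contradiction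
    (injective (trans φk⁺⁺ (trans (next-injective (trans (sym φk⁺′) φk⁺)) (sym φk))))
    (next²-fixes-none k)

  keep : ∀ k → Keep k
  keep = next-induction Keep keep₀ step
... | inj₂ reverse₀ = 1F , l 0F , fold-step prev l λ k → trans (sym (prev-next (l (next k))))
        (cong prev (trans (sym (proj₁ (reverse (next k)))) (proj₂ (reverse k))))
  where
  Reverse : Position → Set
  Reverse k = φ k ≡ next (l k) × φ (next k) ≡ l k

  step : ∀ k → Reverse k → Reverse (next k)
  step k (φk , φk⁺) with meet (next k)
  ... | inj₂ reverse       = reverse
  ... | inj₁ (φk⁺′ , φk⁺⁺) = contradiction
    (injective (trans φk⁺⁺ (trans (cong next (trans (sym φk⁺′) φk⁺)) (sym φk))))
    (next²-fixes-none k)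

  reverse : ∀ k → Reverse k
  reverse = next-induction Reverse reverse₀ step

meet? : ∀ e f l → Dec (Meet e f l)
meet? e f l = (e ≟ l ×-dec f ≟ next l) ⊎-dec (e ≟ next l ×-dec f ≟ l)

abstract

  act-inverse : ∀ r b → ∃[ r′ ] ∃[ b′ ] ∀ k → act r b (act r′ b′ k) ≡ k × act r′ b′ (act r b k) ≡ k
  act-inverse = from-yes (all? λ r → all? λ b → any? λ r′ → any? λ b′ → all? λ k →
    act r b (act r′ b′ k) ≟ k ×-dec act r′ b′ (act r b k) ≟ k)

  -- The second parameter of `act` is the image of `0F`, which is `act r b b′` for the composite;
  -- only the orientation `r″` remains to be found.
  act-∘ : ∀ r b r′ b′ → ∃[ r″ ] ∀ k → act r b (act r′ b′ k) ≡ act r″ (act r b b′) k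
  act-∘ = from-yes (all? λ r → all? λ b → all? λ r′ → all? λ b′ → any? λ r″ →
    all? λ k → act r b (act r′ b′ k) ≟ act r″ (act r b b′) k)

  -- A converse to `Meet⇒act`. The edges need their own parameters: the corner `l` lies between the
  -- edges `l` and `next l`, so a reflection sends `0F` to different positions as an edge and as a
  -- corner.
  act-edges : ∀ r b → ∃[ r′ ] ∃[ b′ ] ∀ k → Meet (act r′ b′ k) (act r′ b′ (next k)) (act r b k)
  act-edges = from-yes (all? λ r → all? λ b → any? λ r′ → any? λ b′ → all? λ k →
    meet? (act r′ b′ k) (act r′ b′ (next k)) (act r b k))

act-permutation : Fin 2 → Position → Permutation′ 5
act-permutation r b with act-inverse r b
... | r′ , b′ , inverse = permutation (act r b) (act r′ b′)
        (λ k → proj₁ (inverse k)) (λ k → proj₂ (inverse k))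

infix 4 _≅_

-- Replaces the edge permutation in `AngleCongruent` by one of ten explicit symmetries, whose
-- inverses and composites are found by finite checks.
_≅_ : (Position → ℝ) → (Position → ℝ) → Set
f ≅ g = ∃[ r ] ∃[ b ] ∀ k → f k ≈ g (act r b k)

≅-sym : ∀ {f g} → f ≅ g → g ≅ f
≅-sym {f} {g} (r , b , f≈g) with act-inverse r b
... | r′ , b′ , inverse = r′ , b′ , λ k → ≈-sym (subst (λ l → f (act r′ b′ k) ≈ g l)
        (proj₁ (inverse k)) (f≈g (act r′ b′ k)))

≅-trans : ∀ {f g h} → f ≅ g → g ≅ h → f ≅ h
≅-trans {f} {g} {h} (r , b , f≈g) (r′ , b′ , g≈h) with act-∘ r′ b′ r b
... | r″ , composite = r″ , act r′ b′ b , λ k → ≈-trans (f≈g k)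
        (subst (λ l → g (act r b k) ≈ h l) (composite k) (g≈h (act r b k)))

module _ (t : Angles) where

  tileAngles : Tile → Position → ℝ
  tileAngles i k = t (i , k)

  congruent⇒≅ : ∀ {i j} → AngleCongruent t i j → tileAngles i ≅ tileAngles j
  congruent⇒≅ {i} {j} (φ , corner) with Meet⇒act {φ ⟨$⟩ʳ_} {proj₁ ∘ corner} injective (proj₁ ∘ proj₂ ∘ corner)
    where
    injective : ∀ {k l} → φ ⟨$⟩ʳ k ≡ φ ⟨$⟩ʳ l → k ≡ l
    injective eq = trans (sym (inverseˡ φ)) (trans (cong (φ ⟨$⟩ˡ_) eq) (inverseˡ φ))
  ... | r , b , l≡act = r , b , λ k → subst (λ l → t (i , k) ≈ t (j , l)) (l≡act k)
          (proj₂ (proj₂ (corner k)))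

  ≅⇒congruent : ∀ {i j} → tileAngles i ≅ tileAngles j → AngleCongruent t i j
  ≅⇒congruent (r , b , ti≈tj) with act-edges r b
  ... | r′ , b′ , meet = act-permutation r′ b′ , λ k → act r b k , meet k , ti≈tj k

-- Words and the search for balanced tilings

_≟ᴸ_ : DecidableEquality Letter
𝛂 ≟ᴸ 𝛂 = yes refl
𝛂 ≟ᴸ 𝛃 = no λ ()
𝛂 ≟ᴸ 𝛄 = no λ ()
𝛃 ≟ᴸ 𝛂 = no λ ()
𝛃 ≟ᴸ 𝛃 = yes refl
𝛃 ≟ᴸ 𝛄 = no λ ()
𝛄 ≟ᴸ 𝛂 = no λ ()
𝛄 ≟ᴸ 𝛃 = no λ ()
𝛄 ≟ᴸ 𝛄 = yes refl

Word : Set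
Word = Vec Letter 5

_≟ᵂ_ : DecidableEquality Word
_≟ᵂ_ = Vec.≡-dec _≟ᴸ_

open DecMembership _≟ᵂ_ using () renaming (_∈?_ to _∈ᵂ?_)
open DecMembership (List.≡-dec _≟ᵂ_) using () renaming (_∈?_ to _∈ᵂˢ?_)
open DecMembership (_≟_ {12}) using () renaming (_∈?_ to _∈ᵀ?_)

image : Word → Fin 2 → Position → Word
image x r b = Vec.tabulate (lookup x ∘ act r b)

allImages : Word → List Word
allImages x = map (image x 0F) (allFin 5) ++ map (image x 1F) (allFin 5)

-- Palindromic words have repeated images, which would slow the search down.
images : Word → List Word
images x = deduplicate _≟ᵂ_ (allImages x)

∈-images⁺ : ∀ x r b → image x r b ∈ images x
∈-images⁺ x r b = ∈-deduplicate⁺ _≟ᵂ_ {xs = allImages x} (∈-allImages r)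
  where
  ∈-allImages : ∀ r → image x r b ∈ allImages x
  ∈-allImages 0F = ∈-++⁺ˡ (∈-map⁺ (image x 0F) (∈-allFin b))
  ∈-allImages 1F = ∈-++⁺ʳ (map (image x 0F) (allFin 5)) (∈-map⁺ (image x 1F) (∈-allFin b))

∈-images⁻ : ∀ x {w} → w ∈ images x → ∃[ r ] ∃[ b ] w ≡ image x r b
∈-images⁻ x w∈ with ∈-++⁻ (map (image x 0F) (allFin 5)) (∈-deduplicate⁻ _≟ᵂ_ (allImages x) w∈)
... | inj₁ w∈₀ = let b , _ , w≡ = ∈-map⁻ (image x 0F) w∈₀ in 0F , b , w≡
... | inj₂ w∈₁ = let b , _ , w≡ = ∈-map⁻ (image x 1F) w∈₁ in 1F , b , w≡

vectors : ∀ {A : Set} → List A → ∀ n → List (Vec A n)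
vectors xs zero    = [] ∷ []
vectors xs (suc n) = cartesianProductWith _∷_ xs (vectors xs n)

∈-vectors : ∀ {A : Set} {xs : List A} → (∀ x → x ∈ xs) → ∀ {n} (v : Vec A n) → v ∈ vectors xs n
∈-vectors complete []      = here refl
∈-vectors complete (x ∷ v) = ∈-cartesianProductWith⁺ _∷_ (complete x) (∈-vectors complete v)

subsets : List (Subset 6)
subsets = vectors (true ∷ false ∷ []) 6

∈-subsets : ∀ S → S ∈ subsets
∈-subsets = ∈-vectors {xs = true ∷ false ∷ []} λ { true → here refl ; false → there (here refl) }

allTiles : List Tile
allTiles = allFin 12

-- A junk value if i is not in is.
wordAt : List Tile → List Word → Words
wordAt (j ∷ is) (w ∷ ws) i = if does (j ≟ i) then w else wordAt is ws i
wordAt _        _        i = Vec.replicate 5 𝛂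

wordAt-map : ∀ (w : Words) {is i} → i ∈ is → wordAt is (map w is) i ≡ w i
wordAt-map w {j ∷ is} {i} i∈ with j ≟ i
... | yes refl = refl
... | no j≢i with i∈
...   | here i≡j    = contradiction (sym i≡j) j≢i
...   | there i∈is = wordAt-map w i∈is

wordAt-allTiles : ∀ w i → wordAt allTiles (map w allTiles) i ≡ w i
wordAt-allTiles w i = wordAt-map w (∈-allFin i)

totalExcess : Words → List Corner → ℤ
totalExcess w cs = foldr ℤ._+_ 0ℤ (map (λ (i , k) → excess (lookup (w i) k)) cs)

totalExcess-cong : ∀ {w w′ : Words} {cs} → All (λ (i , _) → w i ≡ w′ i) cs →
                   totalExcess w cs ≡ totalExcess w′ cs
totalExcess-cong []           = refl
totalExcess-cong (wi≡ ∷ w≡w′) =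
  cong₂ ℤ._+_ (cong (λ u → excess (lookup u _)) wi≡) (totalExcess-cong w≡w′)

Balanced : Words → List (List Corner) → Set
Balanced w = All (λ cs → totalExcess w cs ≡ 0ℤ)

-- css comes first, so that it is evaluated only once in a search.
balanced? : ∀ css is ws → Dec (Balanced (wordAt is ws) css)
balanced? css is ws = All.all? (λ cs → totalExcess (wordAt is ws) cs ℤ.≟ 0ℤ) css

-- The vertices of i that can be tested once the words of i ∷ is are chosen.
closedVertices : Tile → List Tile → List (List Corner)
closedVertices i is = filter (All.all? λ (j , _) → j ∈ᵀ? (i ∷ is))
  (map (λ k → cornersAt (vertex (i , k))) (allFin 5))

-- Words are chosen from the last tile of the list to the first, and a partial choice is dropped as
-- soon as a completed vertex is unbalanced.
solutions : List Word → List Tile → List (List Word)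
solutions candidates []       = [] ∷ []
solutions candidates (i ∷ is) =
  filter (balanced? (closedVertices i is) (i ∷ is))
    (cartesianProductWith _∷_ candidates (solutions candidates is))

-- The pruning never discards a balanced `w`: a vertex is tested only when all its corners have
-- words, and `wordAt` then returns the words of `w`.
∈-solutions : ∀ {candidates} {w : Words} → (∀ i → w i ∈ candidates) →
              (∀ c → totalExcess w (cornersAt (vertex c)) ≡ 0ℤ) →
              ∀ is → map w is ∈ solutions candidates is
∈-solutions     candidate balanced []       = here refl
∈-solutions {w = w} candidate balanced (i ∷ is) =
  ∈-filter⁺ (balanced? (closedVertices i is) (i ∷ is))
    (∈-cartesianProductWith⁺ _∷_ (candidate i) (∈-solutions candidate balanced is))
    (All.tabulate closed-balanced)
  where
  closed-balanced : ∀ {cs} → cs ∈ closedVertices i is →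
                    totalExcess (wordAt (i ∷ is) (map w (i ∷ is))) cs ≡ 0ℤ
  closed-balanced cs∈ with ∈-filter⁻ (All.all? λ (j , _) → j ∈ᵀ? (i ∷ is))
                             {xs = map (λ k → cornersAt (vertex (i , k))) (allFin 5)} cs∈
  ... | cs∈tile , known with ∈-map⁻ (λ k → cornersAt (vertex (i , k))) cs∈tile
  ...   | k , _ , cs≡ = trans (totalExcess-cong (All.map (wordAt-map w) known))
                          (trans (cong (totalExcess w) cs≡) (balanced (i , k)))

tilings : List Words
tilings = tilingI ∷ map tilingIIExchanged subsets

tilings-listed : ∀ {w} → w ∈ tilings → Listed w
tilings-listed (here refl) = I
tilings-listed (there w∈) with ∈-map⁻ tilingIIExchanged {xs = subsets} w∈
... | S , _ , refl = II S

listed-tilings : ∀ {w} → Listed w → w ∈ tilings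
listed-tilings I      = here refl
listed-tilings (II S) = there (∈-map⁺ tilingIIExchanged {xs = subsets} (∈-subsets S))

tilingWords : List (List Word)
tilingWords = map (λ w → map w allTiles) tilings

-- The rotation by one step around P₁ and P₁₂.
turn : Tile → Tile
turn P₁  = P₁
turn P₂  = P₃
turn P₃  = P₄
turn P₄  = P₅
turn P₅  = P₆
turn P₆  = P₂
turn P₇  = P₈
turn P₈  = P₉
turn P₉  = P₁₀
turn P₁₀ = P₁₁
turn P₁₁ = P₇
turn P₁₂ = P₁₂

rotate : ℕ → Tile → Tile
rotate n i = fold i turn n

-- The rotation carries the neighbour lists of the tiles other than P₁ and
-- P₁₂ to each other entry by entry.
shift : ℕ → Tile → Position
shift n P₁  = fold 0F next n
shift n P₁₂ = fold 0F prev n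
shift n _   = 0F

-- w, carried back by n steps of the rotation.
pull : ℕ → Words → Words
pull n w i = image (w (rotate n i)) 0F (shift n i)

wordI wordII : Word
wordI  = 𝛄 ∷ 𝛂 ∷ 𝛃 ∷ 𝛃 ∷ 𝛂 ∷ []
wordII = 𝛃 ∷ 𝛂 ∷ 𝛃 ∷ 𝛄 ∷ 𝛂 ∷ []

-- One word for each way to arrange α, α, β, β, γ cyclically up to reflection.
classes : List Word
classes = wordI ∷ wordII ∷ (𝛂 ∷ 𝛂 ∷ 𝛃 ∷ 𝛃 ∷ 𝛄 ∷ []) ∷ (𝛂 ∷ 𝛂 ∷ 𝛃 ∷ 𝛄 ∷ 𝛃 ∷ []) ∷ []

-- Assignments are compared as lists of twelve words, because membership in a list of lists is
-- decidable.
Covered : List (List Word) → Words → Set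
Covered table w = ∃[ r ] map (pull (toℕ {5} r) w) allTiles ∈ table

covered? : ∀ table ws → Dec (Covered table (wordAt allTiles ws))
covered? table ws = any? λ r → map (pull (toℕ r) (wordAt allTiles ws)) allTiles ∈ᵂˢ? table

abstract

  -- The exhaustive search. For the last two classes it finds nothing at all, since pulling back
  -- keeps the class of a word and the listed tilings consist of images of `wordI` or `wordII`.
  solutions-covered :
    All (λ x → All (Covered tilingWords ∘ wordAt allTiles) (solutions (images x) allTiles)) classes
  solutions-covered = from-yes (All.all?
    {P = λ x → All (Covered tilingWords ∘ wordAt allTiles) (solutions (images x) allTiles)}
    (λ x → All.all? (covered? tilingWords) (solutions (images x) allTiles)) classes)

  tilings-balanced :
    All (λ ws → Balanced (wordAt allTiles ws) (map (cornersAt ∘ vertex) corners)) tilingWords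
  tilings-balanced = from-yes
    (All.all? (balanced? (map (cornersAt ∘ vertex) corners) allTiles) tilingWords)

-- Symmetries of the pattern

lookup-⁅⁆ : ∀ {n} (a x : Fin n) → lookup ⁅ a ⁆ x ≡ does (x ≟ a)
lookup-⁅⁆ zero    zero    = refl
lookup-⁅⁆ zero    (suc x) = Vec.lookup-replicate x false
lookup-⁅⁆ (suc a) zero    = refl
lookup-⁅⁆ (suc a) (suc x) = lookup-⁅⁆ a x

lookup-∪ : ∀ {n} {p q p′ q′ : Subset n} {x y} → lookup p x ≡ lookup p′ y →
           lookup q x ≡ lookup q′ y → lookup (p ∪ q) x ≡ lookup (p′ ∪ q′) y
lookup-∪ {p = p} {q} {p′} {q′} {x} {y} p≡ q≡ = trans (Vec.lookup-zipWith _∨_ x p q)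
  (trans (cong₂ _∨_ p≡ q≡) (sym (Vec.lookup-zipWith _∨_ y p′ q′)))

lookup-ext : ∀ {A : Set} {n} {xs ys : Vec A n} → lookup xs ≗ lookup ys → xs ≡ ys
lookup-ext {xs = xs} {ys} xs≗ys = trans (sym (Vec.tabulate∘lookup xs))
  (trans (Vec.tabulate-cong xs≗ys) (Vec.tabulate∘lookup ys))

abstract

  neighbour-injective : ∀ i {k l} → neighbour i k ≡ neighbour i l → k ≡ l
  neighbour-injective i {k} {l} = from-yes (all? λ i → all? λ k → all? λ l →
    (neighbour i k ≟ neighbour i l) →-dec (k ≟ l)) i k l

  vertex⇒Meet : ∀ i e f l → e ≢ f → vertex (i , l) ≡ V i (neighbour i e) (neighbour i f) → Meet e f l
  vertex⇒Meet = from-yes (all? λ i → all? λ e → all? λ f → all? λ l →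
    ¬? (e ≟ f) →-dec (vertex (i , l) ≟ᵛ V i (neighbour i e) (neighbour i f)) →-dec meet? e f l)

module SymmetryProperties (s : Symmetry) where
  open Symmetry s

  σ⁻¹ : Tile → Tile
  σ⁻¹ = tiles ⟨$⟩ˡ_

  σ-σ⁻¹ : ∀ i → σ (σ⁻¹ i) ≡ i
  σ-σ⁻¹ i = inverseʳ tiles

  σ-injective : ∀ {i j} → σ i ≡ σ j → i ≡ j
  σ-injective eq = trans (sym (inverseˡ tiles)) (trans (cong σ⁻¹ eq) (inverseˡ tiles))

  lookup-V-σ : ∀ a b c x → lookup (V (σ a) (σ b) (σ c)) (σ x) ≡ lookup (V a b c) x
  lookup-V-σ a b c x = lookup-∪ {p = ⁅ σ a ⁆} {⁅ σ b ⁆ ∪ ⁅ σ c ⁆} {⁅ a ⁆} {⁅ b ⁆ ∪ ⁅ c ⁆}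
    (at a) (lookup-∪ {p = ⁅ σ b ⁆} {⁅ σ c ⁆} {⁅ b ⁆} {⁅ c ⁆} (at b) (at c))
    where
    at : ∀ d → lookup ⁅ σ d ⁆ (σ x) ≡ lookup ⁅ d ⁆ x
    at d = trans (lookup-⁅⁆ (σ d) (σ x)) (trans
      (does-⇔ (mk⇔ σ-injective (cong σ)) (σ x ≟ σ d) (x ≟ d)) (sym (lookup-⁅⁆ d x)))

  -- Vertices are sets of tiles, so equality is tested on members. Membership is preserved because
  -- `σ` is injective, and every tile is tested in the image because `σ` is surjective.
  V-σ-⇔ : ∀ {a b c a′ b′ c′} →
          V (σ a) (σ b) (σ c) ≡ V (σ a′) (σ b′) (σ c′) ⇔ V a b c ≡ V a′ b′ c′
  V-σ-⇔ {a} {b} {c} {a′} {b′} {c′} = mk⇔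
    (λ eq → lookup-ext λ x → trans (sym (lookup-V-σ a b c x))
      (trans (cong (λ v → lookup v (σ x)) eq) (lookup-V-σ a′ b′ c′ x)))
    (λ eq → lookup-ext λ y → subst
      (λ y → lookup (V (σ a) (σ b) (σ c)) y ≡ lookup (V (σ a′) (σ b′) (σ c′)) y) (σ-σ⁻¹ y)
      (trans (lookup-V-σ a b c (σ⁻¹ y))
        (trans (cong (λ v → lookup v (σ⁻¹ y)) eq) (sym (lookup-V-σ a′ b′ c′ (σ⁻¹ y))))))

  -- A `Symmetry` is given on tiles only; its effect on an edge is recovered from the adjacency of
  -- the two tiles that share the edge.
  edgeImage : Tile → Position → Position
  edgeImage i k = proj₁ (Equivalence.to (adjacent i (neighbour i k)) (k , refl))

  neighbour-edgeImage : ∀ i k → neighbour (σ i) (edgeImage i k) ≡ σ (neighbour i k)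
  neighbour-edgeImage i k = proj₂ (Equivalence.to (adjacent i (neighbour i k)) (k , refl))

  edgeImage-injective : ∀ i {k l} → edgeImage i k ≡ edgeImage i l → k ≡ l
  edgeImage-injective i {k} {l} eq = neighbour-injective i (σ-injective
    (trans (sym (neighbour-edgeImage i k))
      (trans (cong (neighbour (σ i)) eq) (neighbour-edgeImage i l))))

  -- `GivenBy` provides an image for each corner separately. Consecutive edges of a tile meet at
  -- these images, so by `Meet⇒act` they come from one pentagon symmetry per tile; `P` carries the
  -- angle equations along.
  cornerImage-act : ∀ {P : Tile → Position → Position → Set} →
    (∀ i k → ∃[ l ] CornerImage s i k l × P i k l) →
    ∀ i → ∃[ r ] ∃[ b ] ∀ k → CornerImage s i k (act r b k) × P i k (act r b k)
  cornerImage-act {P} image i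
    with Meet⇒act {edgeImage i} {λ k → proj₁ (image i k)} (edgeImage-injective i) meet
    where
    meet : ∀ k → Meet (edgeImage i k) (edgeImage i (next k)) (proj₁ (image i k))
    meet k = vertex⇒Meet (σ i) (edgeImage i k) (edgeImage i (next k)) (proj₁ (image i k))
      (λ eq → next-fixes-none k (sym (edgeImage-injective i eq)))
      (subst₂ (λ a b → vertex (σ i , proj₁ (image i k)) ≡ V (σ i) a b)
        (sym (neighbour-edgeImage i k)) (sym (neighbour-edgeImage i (next k)))
        (proj₁ (proj₂ (image i k))))
  ... | r , b , l≡act = r , b , λ k →
    subst (λ l → CornerImage s i k l × P i k l) (l≡act k) (proj₂ (image i k))

  module _ (M : CommutativeMonoid 0ℓ 0ℓ) where
    open CommutativeMonoid M using () renaming (Carrier to R; _≈_ to _≃_; trans to ≃-trans; sym to ≃-sym)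
    open CornerSums M

    -- Reindex the sum over all corners along the symmetry. By `V-σ-⇔`, a corner lies at the given
    -- vertex exactly when its image lies at the image vertex.
    vertexSum-image : ∀ {t u : Corner → R} (r : Tile → Fin 2) (b : Tile → Position) →
      (∀ i k → CornerImage s i k (act (r i) (b i) k)) →
      (∀ i k → t (σ i , act (r i) (b i) k) ≃ u (i , k)) →
      ∀ i k → vertexSum t (vertex (σ i , act (r i) (b i) k)) ≃ vertexSum u (vertex (i , k))
    vertexSum-image {t} {u} r b image t≃u i k = ≃-trans (vertexSum-∑ t v) (≃-trans
      (∑∑-permute (λ c → only (vertex c ≟ᵛ v) (t c)) tiles (λ j → act-permutation (r j) (b j)))
      (≃-trans
        (∑∑-cong λ (j , l) → only-cong
          {p? = vertex (σ j , act (r j) (b j) l) ≟ᵛ v} {vertex (j , l) ≟ᵛ vertex (i , k)}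
          (mk⇔
            (λ eq → Equivalence.to V-σ-⇔ (trans (sym (image j l)) (trans eq (image i k))))
            (λ eq → trans (image j l) (trans (Equivalence.from V-σ-⇔ eq) (sym (image i k)))))
          (t≃u j l))
        (≃-sym (vertexSum-∑ u (vertex (i , k))))))
      where v = vertex (σ i , act (r i) (b i) k)

-- Classes of words and rotations of the pattern

count : Letter → (Position → Letter) → ℕ
count x f = ∑.sum λ k → if does (f k ≟ᴸ x) then 1 else 0
  where module ∑ = Algebra.Properties.CommutativeMonoid.Sum ℕ.+-0-commutativeMonoid

count-permute : ∀ x f (ρ : Permutation′ 5) → count x (f ∘ (ρ ⟨$⟩ʳ_)) ≡ count x f
count-permute x f ρ = sym (∑.sum-permute (λ k → if does (f k ≟ᴸ x) then 1 else 0) ρ)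
  where module ∑ = Algebra.Properties.CommutativeMonoid.Sum ℕ.+-0-commutativeMonoid

letters : List Letter
letters = 𝛂 ∷ 𝛃 ∷ 𝛄 ∷ []

∈-letters : ∀ x → x ∈ letters
∈-letters 𝛂 = here refl
∈-letters 𝛃 = there (here refl)
∈-letters 𝛄 = there (there (here refl))

abstract

  -- Checked over all 243 words; two letters `𝛂` and two `𝛃` leave room for exactly one `𝛄`.
  classes-complete : ∀ w → count 𝛂 (lookup w) ≡ 2 → count 𝛃 (lookup w) ≡ 2 →
                     Any (λ x → w ∈ images x) classes
  classes-complete w = All.lookup (from-yes (All.all? (λ w →
    (count 𝛂 (lookup w) ℕ.≟ 2) →-dec (count 𝛃 (lookup w) ℕ.≟ 2) →-dec
    Any.any? (λ x → w ∈ᵂ? images x) classes) (vectors letters 5))) (∈-vectors ∈-letters w)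

  turn-inverse : ∀ (r : Fin 5) i → rotate (toℕ r) (rotate (5 ℕ.∸ toℕ r) i) ≡ i ×
                                   rotate (5 ℕ.∸ toℕ r) (rotate (toℕ r) i) ≡ i
  turn-inverse = from-yes (all? λ r → all? λ i →
    (rotate (toℕ {5} r) (rotate (5 ℕ.∸ toℕ r) i) ≟ i) ×-dec
    (rotate (5 ℕ.∸ toℕ r) (rotate (toℕ r) i) ≟ i))

  turn-adjacent : ∀ (r : Fin 5) i j →
    (Adjacent i j → Adjacent (rotate (toℕ r) i) (rotate (toℕ r) j)) ×
    (Adjacent (rotate (toℕ r) i) (rotate (toℕ r) j) → Adjacent i j)
  turn-adjacent = from-yes (all? λ r → all? λ i → all? λ j →
    (adjacent? i j →-dec adjacent? (rotate (toℕ {5} r) i) (rotate (toℕ r) j)) ×-dec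
    (adjacent? (rotate (toℕ r) i) (rotate (toℕ r) j) →-dec adjacent? i j))
    where
    adjacent? : ∀ i j → Dec (Adjacent i j)
    adjacent? i j = any? λ k → neighbour i k ≟ j

rotation : Fin 5 → Symmetry
rotation r = record
  { tiles    = permutation (rotate (toℕ r)) (rotate (5 ℕ.∸ toℕ r))
                 (proj₁ ∘ turn-inverse r) (proj₂ ∘ turn-inverse r)
  ; adjacent = λ i j → mk⇔ (proj₁ (turn-adjacent r i j)) (proj₂ (turn-adjacent r i j))
  }

abstract

  rotation-cornerImage : ∀ r i k → CornerImage (rotation r) i k (act 0F (shift (toℕ r) i) k)
  rotation-cornerImage = from-yes (all? λ r → all? λ i → all? λ k →
    vertex (rotate (toℕ {5} r) i , act 0F (shift (toℕ r) i) k) ≟ᵛ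
    V (rotate (toℕ r) i) (rotate (toℕ r) (neighbour i k)) (rotate (toℕ r) (neighbour i (next k))))

-- The words of the listed tilings

abstract

  tilingI-images : ∀ i → tilingI i ∈ images wordI
  tilingI-images = from-yes (all? λ i → tilingI i ∈ᵂ? images wordI)

  -- The six edges pair off the twelve tiles, so each tile is altered at most once. Its corners at
  -- that edge are `𝛃` and `𝛄`, and swapping them reflects the word in the axis through the other
  -- `𝛃`.
  tilingII-images : ∀ S i → tilingIIExchanged S i ∈ images wordII
  tilingII-images S = All.lookup
    (from-yes (All.all? {P = λ S → ∀ i → tilingIIExchanged S i ∈ images wordII}
      (λ S → all? λ i → tilingIIExchanged S i ∈ᵂ? images wordII) subsets))
    (∈-subsets S)

sorted : Word
sorted = 𝛂 ∷ 𝛂 ∷ 𝛃 ∷ 𝛃 ∷ 𝛄 ∷ []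

Arranges : Word → Word → Set
Arranges x y = Σ[ ρ ∈ Permutation′ 5 ] ∀ k → lookup x (ρ ⟨$⟩ʳ k) ≡ lookup y k

wordI-sorted : Arranges wordI sorted
wordI-sorted =
  permutation (lookup p) (lookup q)
    (from-yes (all? λ k → lookup p (lookup q k) ≟ k))
    (from-yes (all? λ k → lookup q (lookup p k) ≟ k)) ,
  from-yes (all? λ k → lookup wordI (lookup p k) ≟ᴸ lookup sorted k)
  where
  p q : Vec Position 5
  -- `p` lists the positions of 𝛂, 𝛂, 𝛃, 𝛃, 𝛄 in `wordI`, and `q` is its inverse.
  p = 1F ∷ 4F ∷ 2F ∷ 3F ∷ 0F ∷ []
  q = 4F ∷ 0F ∷ 2F ∷ 3F ∷ 1F ∷ []

wordII-sorted : Arranges wordII sorted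
wordII-sorted =
  permutation (lookup p) (lookup q)
    (from-yes (all? λ k → lookup p (lookup q k) ≟ k))
    (from-yes (all? λ k → lookup q (lookup p k) ≟ k)) ,
  from-yes (all? λ k → lookup wordII (lookup p k) ≟ᴸ lookup sorted k)
  where
  p q : Vec Position 5
  p = 1F ∷ 4F ∷ 0F ∷ 2F ∷ 3F ∷ []
  q = 2F ∷ 0F ∷ 3F ∷ 4F ∷ 1F ∷ []

listed-class : ∀ {w} → Listed w → ∃[ x ] Arranges x sorted × (∀ i → w i ∈ images x)
listed-class I      = wordI , wordI-sorted , tilingI-images
listed-class (II S) = wordII , wordII-sorted , tilingII-images S

listed-balanced : ∀ {w} → Listed w → ∀ c → totalExcess w (cornersAt (vertex c)) ≡ 0ℤ
listed-balanced {w} listed c@(i , k) = trans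
  (sym (totalExcess-cong {wordAt allTiles (map w allTiles)} {w} {cornersAt (vertex c)}
    (All.tabulate λ { {j , _} _ → wordAt-allTiles w j })))
  (All.lookup {xs = map (cornersAt ∘ vertex) corners}
    (All.lookup {xs = tilingWords} tilings-balanced
      (∈-map⁺ (λ w → map w allTiles) {xs = tilings} (listed-tilings listed)))
    (∈-map⁺ (cornersAt ∘ vertex) {xs = corners}
      (∈-cartesianProduct⁺ (∈-allFin i) (∈-allFin k))))

≈-reflexive : ∀ {x y} → x ≡ y → x ≈ y
≈-reflexive {x} refl = ≈-refl {x}

-- Words read as angles

module _ (A B C : ℝ) where

  reading : Word → Position → ℝ
  reading w k = ⟦ lookup w k ⟧ A B C

  readings : Words → Angles
  readings w (i , k) = reading (w i) k

  reading-image : ∀ x r b → reading (image x r b) ≅ reading x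
  reading-image x r b = r , b , λ k → ≈-reflexive
    (cong (λ y → ⟦ y ⟧ A B C) (Vec.lookup∘tabulate (lookup x ∘ act r b) k))

  lookup-sorted : ∀ k → lookup (A ∷ A ∷ B ∷ B ∷ C ∷ []) k ≡ reading sorted k
  lookup-sorted k = Vec.lookup-map k (λ y → ⟦ y ⟧ A B C) sorted

  tile-class : ∀ {t i} → HasAngles t i (A ∷ A ∷ B ∷ B ∷ C ∷ []) →
               ∃[ x ] x ∈ classes × tileAngles t i ≅ reading x
  tile-class {t} {i} (ρ , t≈) =
    let x , x∈ , v∈ = find (classes-complete v
                        (count-permute 𝛂 (lookup sorted) (flip ρ))
                        (count-permute 𝛃 (lookup sorted) (flip ρ)))
        r , b , v≡ = ∈-images⁻ x v∈
    in x , x∈ , r , b , λ k → ≈-trans (t≈v k) (≈-reflexive (cong (λ y → ⟦ y ⟧ A B C)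
         (trans (cong (λ u → lookup u k) v≡) (Vec.lookup∘tabulate (lookup x ∘ act r b) k))))
    where
    v : Word
    -- Undoing `ρ` spells the angles of the tile in cyclic order, with the letter counts of
    -- `sorted`.
    v = Vec.tabulate (lookup sorted ∘ (ρ ⟨$⟩ˡ_))

    t≈v : ∀ k → t (i , k) ≈ reading v k
    t≈v k = ≈-trans
      (subst (λ l → t (i , l) ≈ lookup (A ∷ A ∷ B ∷ B ∷ C ∷ []) (ρ ⟨$⟩ˡ k)) (inverseʳ ρ) (t≈ (ρ ⟨$⟩ˡ k)))
      (≈-reflexive (trans (lookup-sorted (ρ ⟨$⟩ˡ k)) (cong (λ y → ⟦ y ⟧ A B C)
        (sym (Vec.lookup∘tabulate (lookup sorted ∘ (ρ ⟨$⟩ˡ_)) k)))))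

classification : ∀ {x} {w : Words} → x ∈ classes → (∀ i → w i ∈ images x) →
  (∀ c → totalExcess w (cornersAt (vertex c)) ≡ 0ℤ) →
  ∃[ w₀ ] Listed w₀ × ∃[ r ] ∀ i → pull (toℕ {5} r) w i ≡ w₀ i
classification {x} {w} x∈ w∈images balanced =
  let r , pulled∈ = All.lookup {xs = solutions (images x) allTiles}
                      (All.lookup {xs = classes} solutions-covered x∈)
                      (∈-solutions {images x} {w} w∈images balanced allTiles)
      w₀ , w₀∈ , eq = ∈-map⁻ (λ w → map w allTiles) {xs = tilings} pulled∈
  -- The search speaks of lists; `wordAt allTiles` recovers the functions, both for `w` and for its
  -- pullback.
  in w₀ , tilings-listed w₀∈ , r , λ i → trans
       (cong (λ u → image u 0F (shift (toℕ r) i)) (sym (wordAt-allTiles w (rotate (toℕ r) i))))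
       (trans (sym (wordAt-allTiles (pull (toℕ r) (wordAt allTiles (map w allTiles))) i))
         (trans (cong (λ ws → wordAt allTiles ws i) eq) (wordAt-allTiles w₀ i)))

-- From tilings to the list

module FromTiling {A B C : ℝ} (A≈2π/3 : A ≈ 2π/3) (A≉B : ¬ (A ≈ B)) {t : Angles}
         (tiling : IsAngleCongruentTiling t)
         (angles : ∀ i → HasAngles t i (A ∷ A ∷ B ∷ B ∷ C ∷ [])) where

  open IsAngleCongruentTiling tiling

  private
    class₁ : ∃[ x ] x ∈ classes × tileAngles t P₁ ≅ reading A B C x
    class₁ = tile-class A B C {t} {P₁} (angles P₁)

    x : Word
    x = proj₁ class₁

    -- The class is determined at P₁ and carried to the other tiles by congruence, so a single word
    -- `x` serves for all.
    t≅x : ∀ i → tileAngles t i ≅ reading A B C x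
    t≅x i = ≅-trans {tileAngles t i} {tileAngles t P₁} {reading A B C x}
      (congruent⇒≅ t (congruent i P₁)) (proj₂ (proj₂ class₁))

    w : Words
    w i = image x (proj₁ (t≅x i)) (proj₁ (proj₂ (t≅x i)))

    t≈w : ∀ c → t c ≈ readings A B C w c
    t≈w (i , k) = let r , b , t≈x = t≅x i in ≈-trans (t≈x k) (≈-reflexive
      (cong (λ y → ⟦ y ⟧ A B C) (sym (Vec.lookup∘tabulate (lookup x ∘ act r b) k))))

    2B+C≈2π : B + B + C ≈ 2π
    2B+C≈2π = 2β+γ≈2π {A} {B} {C} A≈2π/3 t vertexSum angles

    w-balanced : ∀ c → totalExcess w (cornersAt (vertex c)) ≡ 0ℤ
    w-balanced c = Excess.2π⇒balanced {A} {B} {C} A≈2π/3 2B+C≈2π {f = t} t≈w A≉B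
      (cornersAt (vertex c)) (vertex-degree c) (vertexSum c)

  tiling⇒listed : B + B + C ≈ 2π × (∃[ w₀ ] (Listed w₀ × GivenBy A B C t w₀))
  tiling⇒listed =
    let w₀ , listed , r , pulled = classification {x} {w}
          (proj₁ (proj₂ class₁))
          (λ i → ∈-images⁺ x (proj₁ (t≅x i)) (proj₁ (proj₂ (t≅x i)))) w-balanced
    in 2B+C≈2π , w₀ , listed , rotation r , λ i k →
      act 0F (shift (toℕ r) i) k , rotation-cornerImage r i k ,
      ≈-trans (t≈w (rotate (toℕ r) i , act 0F (shift (toℕ r) i) k)) (≈-reflexive
        (cong (λ y → ⟦ y ⟧ A B C) (trans
          (sym (Vec.lookup∘tabulate (lookup (w (rotate (toℕ r) i)) ∘ act 0F (shift (toℕ r) i)) k))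
          (cong (λ u → lookup u k) (pulled i)))))

-- From the list to tilings

module FromListed {A B C : ℝ} (A≈2π/3 : A ≈ 2π/3) (2B+C≈2π : B + B + C ≈ 2π) {t : Angles} {w : Words}
         (listed : Listed w) (given : GivenBy A B C t w) where

  private
    s : Symmetry
    s = proj₁ given

    open SymmetryProperties s
    open Symmetry s using (σ)

    x : Word
    x = proj₁ (listed-class listed)

    acts : ∀ i → ∃[ r ] ∃[ b ] ∀ k →
           CornerImage s i k (act r b k) × t (σ i , act r b k) ≈ reading A B C (w i) k
    acts = cornerImage-act {λ i k l → t (σ i , l) ≈ reading A B C (w i) k} (proj₂ given)

    r : Tile → Fin 2
    r i = proj₁ (acts i)

    b : Tile → Position
    b i = proj₁ (proj₂ (acts i))

    w≅x : ∀ i → reading A B C (w i) ≅ reading A B C x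
    w≅x i =
      let r , b , wi≡ = ∈-images⁻ x (proj₂ (proj₂ (listed-class listed)) i)
      in subst (λ u → reading A B C u ≅ reading A B C x) (sym wi≡) (reading-image A B C x r b)

    t≅x : ∀ i → tileAngles t i ≅ reading A B C x
    t≅x i = subst (λ j → tileAngles t j ≅ reading A B C x) (σ-σ⁻¹ i)
      (≅-trans {tileAngles t (σ (σ⁻¹ i))} {reading A B C (w (σ⁻¹ i))} {reading A B C x}
        (≅-sym {reading A B C (w (σ⁻¹ i))} {tileAngles t (σ (σ⁻¹ i))}
          (r (σ⁻¹ i) , b (σ⁻¹ i) , λ k → ≈-sym (proj₂ (proj₂ (proj₂ (acts (σ⁻¹ i))) k))))
        (w≅x (σ⁻¹ i)))

    sums-image : ∀ i k → angleSum t (vertex (σ i , act (r i) (b i) k)) ≈ 2π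
    sums-image i k = ≈-trans
      (vertexSum-image +-0-commutativeMonoid {t} {readings A B C w} r b
        (λ j l → proj₁ (proj₂ (proj₂ (acts j)) l)) (λ j l → proj₂ (proj₂ (proj₂ (acts j)) l)) i k)
      (Excess.balanced⇒2π {A} {B} {C} A≈2π/3 2B+C≈2π {f = readings A B C w} (λ c → ≈-refl {readings A B C w c})
        (cornersAt (vertex (i , k)))
        (vertex-degree (i , k)) (listed-balanced listed (i , k)))

    -- Every corner is the image of a corner, as `σ` and the symmetry within each tile are
    -- bijective.
    sums : ∀ c → angleSum t (vertex c) ≈ 2π
    sums (j , l) = subst₂ (λ i k → angleSum t (vertex (i , k)) ≈ 2π) (σ-σ⁻¹ j)
      (inverseʳ (act-permutation (r (σ⁻¹ j)) (b (σ⁻¹ j))))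
      (sums-image (σ⁻¹ j) (act-permutation (r (σ⁻¹ j)) (b (σ⁻¹ j)) ⟨$⟩ˡ l))

  listed⇒tiling : IsAngleCongruentTiling t × (∀ i → HasAngles t i (A ∷ A ∷ B ∷ B ∷ C ∷ []))
  listed⇒tiling = record
    { vertexSum = sums
    ; congruent = λ i j → ≅⇒congruent t (≅-trans {tileAngles t i} {reading A B C x} {tileAngles t j}
        (t≅x i) (≅-sym {tileAngles t j} {reading A B C x} (t≅x j)))
    } , hasAngles
    where
    hasAngles : ∀ i → HasAngles t i (A ∷ A ∷ B ∷ B ∷ C ∷ [])
    hasAngles i =
      let r , b , x≈t  = ≅-sym {tileAngles t i} {reading A B C x} (t≅x i)
          ρ , x≡sorted = proj₁ (proj₂ (listed-class listed))
      in ρ ∘ₚ act-permutation r b , λ k → ≈-trans (≈-sym (x≈t (ρ ⟨$⟩ʳ k))) (≈-reflexive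
           (trans (cong (λ y → ⟦ y ⟧ A B C) (x≡sorted k)) (sym (lookup-sorted A B C k))))

proposition18 : ∀ (α β γ : ℝ) →
    α ≈ 2π/3 → ¬ (α ≈ β) → ¬ (α ≈ γ) → ¬ (β ≈ γ) →
    ∀ (t : Angles) →
    (IsAngleCongruentTiling t × (∀ i → HasAngles t i (α ∷ α ∷ β ∷ β ∷ γ ∷ [])))
    ⇔
    (β + β + γ ≈ 2π × (∃[ w ] (Listed w × GivenBy α β γ t w)))
proposition18 α β γ α≈2π/3 α≉β _ _ t = mk⇔
  (λ (tiling , angles) → FromTiling.tiling⇒listed {α} {β} {γ} α≈2π/3 α≉β {t} tiling angles)
  (λ (2β+γ≈2π , w , listed , given) →
    FromListed.listed⇒tiling {α} {β} {γ} α≈2π/3 2β+γ≈2π {t} {w} listed given)
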